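{- For all but a finite number of graphs $H$, every C46-problem is NP-complete on $H$-free graphs, $H$-contraction-free graphs, $H$-induced-minor-free graphs, and $H$-induced-topological-minor-free graphs. Moreover, in each of the open cases (the remaining graphs $H$), $H$ is a planar $sP_1$-free graph for some $s\geq 1$.
   Context: A graph $G=(V,E)$ has a vertex set $V$ and an edge set $E$ consisting of unordered pairs of vertices. A statement about a problem "on" (or "for") a graph class refers to the problem with input graphs restricted to that class. The independence number of a graph is the size of a largest independent set (set of pairwise non-adjacent vertices) in it. A class of graphs has bounded independence number if there exists a constant $c$ such that every graph in the class has independence number at most $c$. A problem $\Pi$ is a C46-problem if it satisfies both of the following conditions: C4: $\Pi$ is NP-complete for the class of planar graphs; C6: $\Pi$ is NP-complete for some class of graphs of bounded independence number. Graph operations. Vertex deletion (VD) deletes a vertex. Edge contraction (EC) of an edge $uv$ deletes $u$ and $v$ and replaces them by a new vertex made adjacent to precisely those vertices to which $u$ or $v$ were adjacent (without creating parallel edges). Vertex dissolution (VDi) can be applied only to a vertex $v$ of degree $2$ whose two neighbours are not adjacent, and contracts one of the two edges incident with $v$. A graph $G$ contains a graph $H$ as an induced subgraph, contraction, induced minor, or induced topological minor if $H$ can be obtained (up to isomorphism) from $G$ by a (possibly empty) sequence of operations from, respectively, {VD}; {EC, VDi}; {VD, EC, VDi}; {VD, VDi}. $G$ is $H$-free, $H$-contraction-free, $H$-induced-minor-free, or $H$-induced-topological-minor-free if it does not contain $H$ as, respectively, an induced subgraph, a contraction, an induced minor, or an induced topological minor. $sP_1$ denotes the graph consisting of $s$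 isolated vertices.
   Formalization: The finite set of exceptional graphs H may depend on the C46-problem (one set for all problems is impossible: "k-colourable with independence number at least c" fails on cP_1-free graphs), and NP-completeness on a class requires the problem itself to be in NP on all graphs. -}

module Defs where

open import Data.Bool.Base using (Bool; true; false; T; not; _∧_; _∨_)
open import Data.Bool.Properties using (∨-comm)
open import Data.Fin.Base using (Fin; zero; punchIn)
open import Data.Fin.Properties using (_≟_)
open import Data.Fin.Subset using (Subset; _∈_; ∣_∣)
open import Data.List.Base
  using (List; []; _∷_; _++_; length; map; concatMap; allFin)
open import Data.List.Membership.Propositional using () renaming (_∈_ to _∈ˡ_)
open import Data.Maybe.Base as Maybe using (Maybe; just; nothing)
open import Data.Nat.Base using (ℕ; zero; suc; _+_; _*_; _^_; _≤_)
open import Data.Nat.GeneralisedArithmetic using (iterate)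
open import Data.Product.Base using (Σ-syntax; ∃; ∃₂; ∃-syntax; _×_; _,_)
import Data.Vec.Base as Vec
open import Function.Base using (_∘_)
open import Function.Bundles using (_⇔_; mk⇔; _↔_; Inverse)
open import Function.Definitions using (StrictlySurjective)
open import Level using (0ℓ)
open import Relation.Binary.Construct.Closure.ReflexiveTransitive using (Star)
open import Relation.Binary.Core using (Rel)
open import Relation.Binary.PropositionalEquality.Core
  using (_≡_; refl; sym; trans; cong; cong₂; subst)
open import Relation.Nullary.Decidable using (does; dec-true; does-⇔)
open import Relation.Nullary.Negation using (¬_)
open import Relation.Unary using (Pred)

record GraphOn (n : ℕ) : Set where
  field
    adj         : Fin n → Fin n → Bool
    symmetric   : ∀ u v → adj u v ≡ adj v u
    irreflexive : ∀ v → adj v v ≡ false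

  Adj : Rel (Fin n) 0ℓ
  Adj u v = T (adj u v)

  neighbours : Fin n → Subset n
  neighbours v = Vec.tabulate (adj v)

  degree : Fin n → ℕ
  degree v = ∣ neighbours v ∣

open GraphOn public

Graph : Set
Graph = ∃ GraphOn

infix 4 _≅_

_≅_ : Rel Graph 0ℓ
(m , G) ≅ (n , H) =
  Σ[ f ∈ Fin m ↔ Fin n ]
    ∀ u v → adj G u v ≡ adj H (Inverse.to f u) (Inverse.to f v)

infix 10 _P₁

_P₁ : ℕ → Graph
s P₁ = s , record
  { adj         = λ _ _ → false
  ; symmetric   = λ _ _ → refl
  ; irreflexive = λ _ → refl
  }

Independent : ∀ {n} → GraphOn n → Pred (Subset n) 0ℓ
Independent G S = ∀ u v → u ∈ S → v ∈ S → ¬ Adj G u v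

IndependenceNumber : Graph → ℕ → Set
IndependenceNumber (n , G) k =
  (Σ[ S ∈ Subset n ] Independent G S × ∣ S ∣ ≡ k) ×
  (∀ S → Independent G S → ∣ S ∣ ≤ k)

GraphClass : Set₁
GraphClass = Pred Graph 0ℓ

BoundedIndependence : GraphClass → Set
BoundedIndependence 𝒞 =
  ∃[ c ] ∀ G → 𝒞 G → ∃[ k ] IndependenceNumber G k × k ≤ c

delete : ∀ {n} → GraphOn (suc n) → Fin (suc n) → GraphOn n
delete G v = record
  { adj         = λ i j → adj G (punchIn v i) (punchIn v j)
  ; symmetric   = λ i j → symmetric G (punchIn v i) (punchIn v j)
  ; irreflexive = λ i → irreflexive G (punchIn v i)
  }

-- v is removed and u takes the part of the new vertex: u becomes adjacent to
-- the former neighbours of v, other than u itself.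
contract : ∀ {n} → GraphOn (suc n) → (u v : Fin (suc n)) → GraphOn n
contract {n} G u v = record
  { adj         = λ i j → not (does (i ≟ j)) ∧ joined (punchIn v i) (punchIn v j)
  ; symmetric   = λ i j → cong₂ (λ b c → not b ∧ c)
      (does-⇔ (mk⇔ sym sym) (i ≟ j) (j ≟ i))
      (joined-sym (punchIn v i) (punchIn v j))
  ; irreflexive = λ i → cong (λ b → not b ∧ joined (punchIn v i) (punchIn v i))
      (dec-true (i ≟ i) refl)
  }
  where
  inherited : Fin (suc n) → Fin (suc n) → Bool
  inherited x y = does (x ≟ u) ∧ adj G v y

  joined : Fin (suc n) → Fin (suc n) → Bool
  joined x y = adj G x y ∨ (inherited x y ∨ inherited y x)

  joined-sym : ∀ x y → joined x y ≡ joined y x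
  joined-sym x y =
    cong₂ _∨_ (symmetric G x y) (∨-comm (inherited x y) (inherited y x))

data Operation : Set where
  VD EC VDi : Operation

data Step (ops : List Operation) : Rel Graph 0ℓ where
  vertexDeletion : VD ∈ˡ ops →
    ∀ {n} (G : GraphOn (suc n)) v →
    Step ops (suc n , G) (n , delete G v)
  edgeContraction : EC ∈ˡ ops →
    ∀ {n} (G : GraphOn (suc n)) u v → Adj G u v →
    Step ops (suc n , G) (n , contract G u v)
  vertexDissolution : VDi ∈ˡ ops →
    ∀ {n} (G : GraphOn (suc n)) u v → Adj G u v →
    degree G v ≡ 2 →
    (∀ x y → x ∈ neighbours G v → y ∈ neighbours G v → ¬ Adj G x y) →
    Step ops (suc n , G) (n , contract G u v)

Contains : List Operation → Graph → Graph → Set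
Contains ops G H = ∃[ K ] Star (Step ops) G K × K ≅ H

infix 9 _-free _-contraction-free _-induced-minor-free
  _-induced-topological-minor-free

_-free : Graph → GraphClass
(H -free) G = ¬ Contains (VD ∷ []) G H

_-contraction-free : Graph → GraphClass
(H -contraction-free) G = ¬ Contains (EC ∷ VDi ∷ []) G H

_-induced-minor-free : Graph → GraphClass
(H -induced-minor-free) G = ¬ Contains (VD ∷ EC ∷ VDi ∷ []) G H

_-induced-topological-minor-free : Graph → GraphClass
(H -induced-topological-minor-free) G = ¬ Contains (VD ∷ VDi ∷ []) G H

record Dart {n} (G : GraphOn n) : Set where
  constructor dart
  field
    tail head : Fin n
    adjacent  : Adj G tail head

open Dart public

reverse : ∀ {n} {G : GraphOn n} → Dart G → Dart G
reverse {G = G} (dart u v uv) = dart v u (subst T (symmetric G u v) uv)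

Orbit : {A : Set} → (A → A) → Rel A 0ℓ
Orbit f x y = ∃[ k ] iterate f x k ≡ y

-- next d is the dart following d in the cyclic order around its tail.  The
-- condition makes next a permutation with exactly one cycle per nonisolated
-- vertex.
record RotationSystem {n} (G : GraphOn n) : Set where
  field
    next   : Dart G → Dart G
    cycles : ∀ d e → tail d ≡ tail e ⇔ Orbit next d e

  nextOnFace : Dart G → Dart G
  nextOnFace = next ∘ reverse

-- The classifying map exhibits Fin k as the quotient of A by _~_.
HasClasses : {A : Set} → Rel A 0ℓ → ℕ → Set
HasClasses {A} _~_ k =
  Σ[ class ∈ (A → Fin k) ]
    StrictlySurjective _≡_ class × (∀ x y → class x ≡ class y ⇔ x ~ y)

-- Every classification below is of darts, so isolated vertices, which do not
-- affect planarity, are not counted.  Each connected component with an edge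
-- satisfies V - E + F ≤ 2, with equality exactly when it is embedded in the
-- sphere; summed over the C components, equality reads V + F = E + 2C.
record Spherical {n} {G : GraphOn n} (R : RotationSystem G) : Set where
  open RotationSystem R
  field
    V E F C    : ℕ
    vertices   : HasClasses (Orbit next) V
    edges      : HasClasses (Orbit (reverse {G = G})) E
    faces      : HasClasses (Orbit nextOnFace) F
    components : HasClasses {Dart G} (λ d e → Star (Adj G) (tail d) (tail e)) C
    euler      : V + F ≡ E + 2 * C

-- Embeddability in the sphere, in combinatorial form: a rotation system of
-- genus 0.
Planar : GraphClass
Planar (n , G) = ∃ λ (R : RotationSystem G) → Spherical R

data Symbol (k : ℕ) : Set where
  blank : Symbol k
  bit   : Bool → Symbol k
  mark  : Fin k → Symbol k

data Direction : Set where
  left right : Direction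

-- Deterministic, with a single two-way infinite tape.
record Machine : Set where
  field
    states marks : ℕ

  State : Set
  State = Fin (suc states)

  field
    -- nothing: the machine halts
    δ : State → Symbol marks → Maybe (State × Symbol marks × Direction)

module _ (M : Machine) where
  open Machine M

  -- The cells to the left of the head are listed from the head outwards;
  -- cells beyond either list are blank.
  record Configuration : Set where
    constructor config
    field
      state  : State
      before : List (Symbol marks)
      here   : Symbol marks
      after  : List (Symbol marks)

  split : List (Symbol marks) → Symbol marks × List (Symbol marks)
  split []       = blank , []
  split (a ∷ as) = a , as

  move : State → List (Symbol marks) → Symbol marks → List (Symbol marks) →
         Direction → Configuration
  move q ls a rs left  = let (b , ls′) = split ls in config q ls′ b (a ∷ rs)
  move q ls a rs right = let (b , rs′) = split rs in config q (a ∷ ls) b rs′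

  step : Configuration → Maybe Configuration
  step (config q ls a rs) =
    Maybe.map (λ (q′ , a′ , dir) → move q′ ls a′ rs dir) (δ q a)

  -- The halting configuration, if it is reached within t steps.
  run : ℕ → Configuration → Maybe Configuration
  run t c with step c
  run t       c | nothing = just c
  run zero    c | just _  = nothing
  run (suc t) c | just c′ = run t c′

  initial : List Bool → Configuration
  initial w = let (a , rs) = split (map bit w) in config zero [] a rs

  leadingBits : List (Symbol marks) → List Bool
  leadingBits (bit b ∷ as) = b ∷ leadingBits as
  leadingBits _            = []

  -- The output is the maximal string of bits starting at the head.
  output : Configuration → List Bool
  output (config _ _ a rs) = leadingBits (a ∷ rs)

PolynomialTime : (List Bool → List Bool) → Set
PolynomialTime f =
  ∃[ M ] ∃[ c ] ∃[ k ] ∀ w →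
    Maybe.map (output M) (run M (c * length w ^ k + c) (initial M w)) ≡ just (f w)

Language : Set₁
Language = Pred (List Bool) 0ℓ

-- Each bit of the first string is preceded by true; false ends it.
pair : List Bool → List Bool → List Bool
pair x y = concatMap (λ b → true ∷ b ∷ []) x ++ false ∷ y

NP : Language → Set
NP L =
  ∃[ verify ] PolynomialTime verify ×
  (∃[ c ] ∃[ k ] ∀ w →
    L w ⇔ (∃[ y ] length y ≤ c * length w ^ k + c ×
                  verify (pair w y) ≡ true ∷ []))

-- An instance is a graph together with further input (a number of colours,
-- lists of colours, …) encoded as a bit string, which is ignored by problems
-- whose input is just a graph.
GraphProblem : Set₁
GraphProblem = Graph → List Bool → Set

-- The rows of the adjacency matrix, one after the other.  The length n² of the
-- result determines n.
encodeGraph : Graph → List Bool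
encodeGraph (n , G) = concatMap (λ u → map (adj G u) (allFin n)) (allFin n)

encode : Graph → List Bool → List Bool
encode G y = pair (encodeGraph G) y

language : GraphProblem → Language
language Π w = ∃₂ λ G y → w ≡ encode G y × Π G y

-- Restricting the input to 𝒞 is a promise: reductions must produce instances
-- whose graph lies in 𝒞, but 𝒞 need not be efficiently recognisable.
NPHard : GraphProblem → GraphClass → Set₁
NPHard Π 𝒞 = (L : Language) → NP L →
  ∃[ f ] PolynomialTime f ×
  (∀ w → (∃₂ λ G y → 𝒞 G × f w ≡ encode G y) × (L w ⇔ language Π (f w)))

-- Membership in NP is that of the problem itself, not of its restriction: a
-- problem that is in NP merely when restricted to some class may be
-- undecidable on a larger one.
NPComplete : GraphProblem → GraphClass → Set₁
NPComplete Π 𝒞 = NP (language Π) × NPHard Π 𝒞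

C4 : GraphProblem → Set₁
C4 Π = NPComplete Π Planar

C6 : GraphProblem → Set₁
C6 Π = ∃[ 𝒞 ] BoundedIndependence 𝒞 × NPComplete Π 𝒞

C46-Problem : GraphProblem → Set₁
C46-Problem Π = C4 Π × C6 Π

{-# OPTIONS --safe #-}

-- Let c bound the independence numbers of the class in C6 and put s = c + 1.  If
-- H has s independent vertices, then so does every graph containing H, under any
-- of the four relations; hence the class in C6 is H-free.  If H is not planar,
-- then planar graphs are H-free, since planarity is preserved by all operations.
-- Otherwise H has no five pairwise adjacent vertices and no s independent ones,
-- so by Ramsey's theorem it is one of finitely many graphs.
--
-- That planarity is preserved rests on one lemma on pairs of permutations:
-- splitting a cycle by a transposition does not decrease the Euler
-- characteristic minus twice the number of components.  Deleting and contracting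
-- edges are such splittings, and repeating them until nothing is left shows that
-- the quantity is never positive; so once it is zero it stays zero.

module Submission where

open import Data.Bool.Base using (Bool; true; false; T; not; _∧_; _∨_)
open import Data.Bool.Properties using (T?; T-∨; T-irrelevant; ∨-comm; ∨-idem)
open import Data.Empty using (⊥; ⊥-elim)
open import Data.Fin.Base as Fin
  using (Fin; zero; suc; toℕ; punchIn; punchOut; combine; remQuot)
open import Data.Fin.Permutation.Components using (transpose; transpose-inverse)
open import Data.Fin.Properties
  using (_≟_; combine-injectiveˡ; combine-injectiveʳ; combine-remQuot; any?;
         all?; <-cmp; <-asym; injective⇒≤; pigeonhole; punchIn-injective; punchInᵢ≢i;
         punchIn-punchOut; suc-injective; punchOut-cong; punchOut-injective; punchOut-punchIn)
open import Data.Fin.Subset using (Subset; _∈_; ∣_∣)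
open import Data.List.Base as List
  using (List; []; _∷_; _++_; length; map; filter; allFin; cartesianProduct; cartesianProductWith)
open import Data.List.Membership.Propositional using (lose) renaming (_∈_ to _∈ˡ_)
open import Data.List.Membership.Propositional.Properties
  using (∈-allFin; ∈-cartesianProduct⁺; ∈-cartesianProductWith⁺; ∈-filter⁺; ∈-map⁺; ∈-++⁺ˡ; ∈-++⁺ʳ; ∈-lookup)
open import Data.List.Properties using (length-tabulate)
open import Data.List.Relation.Binary.Subset.Propositional using (_⊆_)
open import Data.List.Relation.Binary.Subset.Propositional.Properties
  using (All-resp-⊇; filter-⊆; ∷⁺ʳ)
open import Data.List.Relation.Unary.All.Properties using (all-filter)
open import Data.List.Relation.Unary.AllPairs.Core using (AllPairs; []; _∷_)
import Data.List.Relation.Unary.AllPairs.Properties as AllPairs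
open import Data.List.Relation.Unary.Unique.Propositional.Properties using (allFin⁺)
open import Data.List.Relation.Unary.All as All using (All; []; _∷_)
open import Data.List.Relation.Unary.Any as Any using (Any; here; there)
open import Data.Nat.Base using (ℕ; zero; suc; _+_; _*_; _^_; _≤_; _≥_; _<_; z≤n; s≤s)
open import Data.Nat.GeneralisedArithmetic using (iterate)
import Data.Nat.Properties as ℕ
open import Data.Nat.Tactic.RingSolver using (solve-∀)
open import Data.Product.Base using (∃; Σ-syntax; ∃-syntax; _×_; _,_; proj₁; proj₂; uncurry)
open import Data.Sum.Base as Sum using (_⊎_; inj₁; inj₂)
open import Data.Vec.Base using (Vec; []; _∷_; lookup; tabulate; here; there)
open import Data.Vec.Properties using (lookup∘tabulate; lookup⇒[]=; []=⇒lookup)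
open import Function.Base using (_∘_; _on_; id)
open import Function.Bundles using (_⇔_; mk⇔; Equivalence; Inverse)
open import Function.Definitions using (Injective; StrictlySurjective)
open import Function.Construct.Identity using (↔-id)
open import Level using (0ℓ)
open import Relation.Binary.Construct.Closure.Equivalence as EC
  using (EqClosure)
open import Relation.Binary.Construct.Closure.ReflexiveTransitive as Star
  using (Star; ε; _◅_; _◅◅_)
open import Relation.Binary.Core using (Rel; _⇒_)
open import Relation.Binary.Definitions using (Decidable; tri<; tri≈; tri>)
import Relation.Binary.Construct.On as On
open import Relation.Binary.PropositionalEquality
open import Relation.Binary.Structures using (IsEquivalence)
open import Relation.Nullary.Decidable
  using (Dec; yes; no; map′; does; does-⇔; dec-true; decidable-stable;
         ¬?; _×-dec_; _⊎-dec_; _→-dec_)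
open import Relation.Nullary.Negation using (¬_; contradiction)
open import Defs

open Equivalence using (to; from)

-- The operations leave debris: contraction creates loops and parallel edges, and deletion leaves
-- cycles of darts that carry no vertex. Instead of repairing a rotation system after each step, the
-- proof lets the steps act on `Drawing`s, which tolerate the debris, and `shrink` clears it once at
-- the end. A drawing keeps only half of Euler's formula, `loss ≤ gain`; `genus≥0` supplies the
-- other half when `Planar` asks for an equality.
--
-- Hypermaps treat their two permutations alike, so a single splitting lemma serves both: it removes
-- a point from either permutation, and, applied in the dual, it contracts an edge.
--
-- The open cases are to form an explicit list, so planarity has to be decided. For this, and to
-- have numbers of cycles at all, darts are numbered and everything is transferred from `Dart G` to
-- `Fin m`, where rotation systems can be searched exhaustively.
--
-- The 5 in the bound `2 ^ (5 + s)` is that of K₅, which has 10 edges, while Euler's formula with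
-- faces of at least three sides allows only 9.

private variable
  A B : Set
  k l m n : ℕ
  R S : Rel A 0ℓ
  ops : List Operation

Inj : (A → B) → Set
Inj = Injective _≡_ _≡_

-- Numbers of equivalence classes

-- Representatives of the classes of the coarser `S` lie in distinct classes of `R`, which gives an
-- injection from `Fin l` to `Fin k`.
classes-antitone : HasClasses R k → HasClasses S l → R ⇒ S → l ≤ k
classes-antitone (c , _ , c⇔) (d , d-onto , d⇔) R⇒S =
  injective⇒≤ {f = λ i → c (proj₁ (d-onto i))} λ {i} {j} eq → begin
    i                      ≡⟨ proj₂ (d-onto i) ⟨
    d (proj₁ (d-onto i))   ≡⟨ from (d⇔ _ _) (R⇒S (to (c⇔ _ _) eq)) ⟩
    d (proj₁ (d-onto j))   ≡⟨ proj₂ (d-onto j) ⟩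
    j                      ∎
  where open ≡-Reasoning

classes-unique : HasClasses R k → HasClasses R l → k ≡ l
classes-unique p q =
  ℕ.≤-antisym (classes-antitone q p id) (classes-antitone p q id)

collapse : {i j : Fin (suc k)} → i ≢ j → Fin (suc k) → Fin k
collapse {i = i} i≢j v with i ≟ v
... | yes _  = punchOut i≢j
... | no i≢v = punchOut i≢v

module _ {i j : Fin (suc k)} (i≢j : i ≢ j) where

  collapse-joins : collapse i≢j i ≡ collapse i≢j j
  collapse-joins with i ≟ i | i ≟ j
  ... | no i≢i | _     = contradiction refl i≢i
  ... | yes _  | yes _ = refl
  ... | yes _  | no _  = punchOut-cong i refl

  collapse-punchIn : ∀ v → collapse i≢j (punchIn i v) ≡ v
  collapse-punchIn v with i ≟ punchIn i v
  ... | yes eq = contradiction (sym eq) (punchInᵢ≢i i v)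
  ... | no _   = trans (punchOut-cong i refl) (punchOut-punchIn i)

  collapse-kernel : ∀ v w → collapse i≢j v ≡ collapse i≢j w →
                    v ≡ w ⊎ (v ≡ i × w ≡ j) ⊎ (v ≡ j × w ≡ i)
  collapse-kernel v w eq with i ≟ v | i ≟ w
  ... | yes refl | yes refl = inj₁ refl
  ... | yes refl | no i≢w   = inj₂ (inj₁ (refl , sym (punchOut-injective i≢j i≢w eq)))
  ... | no i≢v   | yes refl = inj₂ (inj₂ (punchOut-injective i≢v i≢j eq , refl))
  ... | no i≢v   | no i≢w   = inj₁ (punchOut-injective i≢v i≢w eq)

-- The join of the kernel of `c` with the pair `(x , y)`, given by its universal property `least` so
-- that it can be compared with any equivalence at hand. At most one class is lost, and exactly one
-- if `c` separates `x` and `y`.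
record Merged (c : A → Fin k) (x y : A) : Set₁ where
  field
    {size}   : ℕ
    class    : A → Fin size
    onto     : StrictlySurjective _≡_ class
    joins    : class x ≡ class y
    coarsens : (_≡_ on c) ⇒ (_≡_ on class)
    least    : {S : Rel A 0ℓ} → IsEquivalence S →
               (_≡_ on c) ⇒ S → S x y → (_≡_ on class) ⇒ S
    loses≤1  : k ≤ suc size
    loses≥1  : c x ≢ c y → size < k

merge : (c : A → Fin k) → StrictlySurjective _≡_ c → ∀ x y → Merged c x y
merge {k = zero}  c onto x y with () ← c x
merge {k = suc k} c onto x y with c x ≟ c y
... | yes cx≡cy = record
  { class = c ; onto = onto ; joins = cx≡cy ; coarsens = id
  ; least = λ _ c⇒S _ → c⇒S
  ; loses≤1 = ℕ.n≤1+n _ ; loses≥1 = contradiction cx≡cy }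
... | no cx≢cy = record
  { class    = collapse cx≢cy ∘ c
  ; onto     = λ i → let (u , cu≡) = onto (punchIn (c x) i) in
                 u , trans (cong (collapse cx≢cy) cu≡) (collapse-punchIn cx≢cy i)
  ; joins    = collapse-joins cx≢cy
  ; coarsens = cong (collapse cx≢cy)
  ; least    = λ {S} S-equiv c⇒S Sxy {u} {v} eq →
      least′ S-equiv c⇒S Sxy (collapse-kernel cx≢cy (c u) (c v) eq)
  ; loses≤1  = ℕ.≤-refl
  ; loses≥1  = λ _ → ℕ.≤-refl
  }
  where
  least′ : {S : Rel _ 0ℓ} → IsEquivalence S → (_≡_ on c) ⇒ S → S x y → ∀ {u v} →
           c u ≡ c v ⊎ (c u ≡ c x × c v ≡ c y) ⊎ (c u ≡ c y × c v ≡ c x) → S u v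
  least′ E c⇒S Sxy (inj₁ u~v)               = c⇒S u~v
  least′ E c⇒S Sxy (inj₂ (inj₁ (u~x , v~y))) =
    IsEquivalence.trans E (c⇒S u~x) (IsEquivalence.trans E Sxy (c⇒S (sym v~y)))
  least′ E c⇒S Sxy (inj₂ (inj₂ (u~y , v~x))) =
    IsEquivalence.trans E (c⇒S u~y)
      (IsEquivalence.trans E (IsEquivalence.sym E Sxy) (c⇒S (sym v~x)))

kernel-equiv : (c : A → B) → IsEquivalence (_≡_ on c)
kernel-equiv c = On.isEquivalence c isEquivalence

module _ {Q : Rel (Fin n) 0ℓ} (Q? : Decidable Q) where

  private
    Partial : List (Fin n × Fin n) → Set
    Partial ps = ∃[ k ] Σ[ c ∈ (Fin n → Fin k) ] StrictlySurjective _≡_ c ×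
      ((_≡_ on c) ⇒ EqClosure Q) ×
      All (λ (x , y) → Q x y → c x ≡ c y) ps

    -- Union-find: the discrete partition is coarsened by one pair at a time. The kernel stays
    -- inside the closure of `Q`, and every processed pair of `Q` is identified.
    mergeAll : ∀ ps → Partial ps
    mergeAll []       =
      n , id , (λ i → i , refl) , (λ { refl → ε }) , []
    mergeAll ((x , y) ∷ ps) with mergeAll ps | Q? x y
    ... | k , c , onto , sound , done | no ¬Qxy =
      k , c , onto , sound , (λ Qxy → contradiction Qxy ¬Qxy) ∷ done
    ... | k , c , onto , sound , done | yes Qxy =
      _ , Merged.class M , Merged.onto M ,
      Merged.least M (EC.isEquivalence Q) sound (EC.return Qxy) ,
      (λ _ → Merged.joins M) ∷ All.map (λ f q → Merged.coarsens M (f q)) done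
      where M = merge c onto x y

  -- This keeps the union-find from being unfolded during type checking; only its specification is
  -- used.
  opaque
    classify : ∃ (HasClasses (EqClosure Q))
    classify = let (k , c , onto , sound , done) = mergeAll (cartesianProduct (allFin n) (allFin n)) in
      k , c , onto , λ x y → mk⇔ sound
        (EC.fold (kernel-equiv c)
          (λ {u} {v} → All.lookup done (∈-cartesianProduct⁺ (∈-allFin u) (∈-allFin v))))

  count : ℕ
  count = proj₁ classify

  count-classes : HasClasses (EqClosure Q) count
  count-classes = proj₂ classify

  connected? : Decidable (EqClosure Q)
  connected? x y = let (c , _ , c⇔) = count-classes in
    map′ (to (c⇔ x y)) (from (c⇔ x y)) (c x ≟ c y)

count-unique : {Q : Rel (Fin n) 0ℓ} (Q? : Decidable Q) →
               HasClasses (EqClosure Q) k → k ≡ count Q?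
count-unique Q? h = classes-unique h (count-classes Q?)

module _ {P Q : Rel (Fin n) 0ℓ} (P? : Decidable P) (Q? : Decidable Q) where

  count-antitone : P ⇒ EqClosure Q → count Q? ≤ count P?
  count-antitone P⇒Q = classes-antitone (count-classes P?) (count-classes Q?)
    (EC.fold (EC.isEquivalence Q) P⇒Q)

  module _ {x y : Fin n} where

    -- Identifying `x` and `y` in the partition of `P` costs a class, and the result is still at
    -- least as fine as the partition of `Q`.
    count-strict : P ⇒ EqClosure Q → EqClosure Q x y → ¬ EqClosure P x y →
                   count Q? < count P?
    count-strict P⇒Q Qxy ¬Pxy =
      let (c , c-onto , c⇔) = count-classes P?
          open Merged (merge c c-onto x y)
          merged = class , onto , λ u v → mk⇔ id id
      in ℕ.≤-<-trans
        (classes-antitone {R = _≡_ on class} merged (count-classes Q?)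
          (least (EC.isEquivalence Q)
            (EC.fold (EC.isEquivalence Q) P⇒Q ∘ to (c⇔ _ _)) Qxy))
        (loses≥1 (¬Pxy ∘ to (c⇔ _ _)))

    -- By the hypothesis, the partition of `P` with `x` and `y` identified is at least as coarse as
    -- that of `Q`, and the identification costs at most one class.
    count-join : (∀ {T : Rel (Fin n) 0ℓ} → IsEquivalence T → P ⇒ T → T x y → Q ⇒ T) →
                 count P? ≤ suc (count Q?)
    count-join Q⇒ =
      let (c , c-onto , c⇔) = count-classes P?
          open Merged (merge c c-onto x y)
          merged = class , onto , λ u v → mk⇔ id id
      in ℕ.≤-trans loses≤1 (s≤s
        (classes-antitone {S = _≡_ on class} (count-classes Q?) merged
          (EC.fold (kernel-equiv class)
            (Q⇒ (kernel-equiv class)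
              (coarsens ∘ from (c⇔ _ _) ∘ EC.return) joins))))

-- Cycles of permutations

-- For a permutation of `Fin n` this agrees with `Orbit`. The closure is an equivalence by
-- construction and folds into any other one.
Conn : (A → A) → Rel A 0ℓ
Conn f = EqClosure (λ x y → f x ≡ y)

iterate-+ : (f : A → A) → ∀ x k l → iterate f x (k + l) ≡ iterate f (iterate f x k) l
iterate-+ f x zero    l = refl
iterate-+ f x (suc k) l = iterate-+ f (f x) k l

iterate-suc : (f : A → A) → ∀ x k → iterate f x (suc k) ≡ f (iterate f x k)
iterate-suc f x zero    = refl
iterate-suc f x (suc k) = iterate-suc f (f x) k

iterate-injective : {f : A → A} → Inj f → ∀ k {x y} →
                    iterate f x k ≡ iterate f y k → x ≡ y
iterate-injective inj zero    eq = eq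
iterate-injective inj (suc k) eq = inj (iterate-injective inj k eq)

orbit-trans : {f : A → A} {x y z : A} → Orbit f x y → Orbit f y z → Orbit f x z
orbit-trans {f = f} {x} (k , refl) (l , refl) = k + l , iterate-+ f x k l

orbit⇒conn : {f : A → A} {x y : A} → Orbit f x y → Conn f x y
orbit⇒conn (zero  , refl) = ε
orbit⇒conn (suc k , eq)   = EC.return refl ◅◅ orbit⇒conn (k , eq)

module _ {f : Fin n → Fin n} (inj : Inj f) where

  -- Two of the `n + 1` iterates indexed by `Fin (suc n)` coincide; injectivity cancels the smaller
  -- exponent.
  period : ∀ x → Orbit f (f x) x
  period x with i , j , i<j , eq ← pigeonhole ℕ.≤-refl (iterate f x ∘ toℕ)
           with p , j≡ ← ℕ.m≤n⇒∃[o]m+o≡n i<j =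
    p , sym (iterate-injective inj (toℕ i) (begin
      iterate f x (toℕ i)                      ≡⟨ eq ⟩
      iterate f x (toℕ j)                      ≡⟨ cong (iterate f x) j≡ ⟨
      iterate f x (suc (toℕ i + p))            ≡⟨ cong (iterate f x ∘ suc) (ℕ.+-comm (toℕ i) p) ⟩
      iterate f x (suc p + toℕ i)              ≡⟨ iterate-+ f x (suc p) (toℕ i) ⟩
      iterate f (iterate f x (suc p)) (toℕ i)  ∎))
    where open ≡-Reasoning

  orbit-sym : ∀ {x y} → Orbit f x y → Orbit f y x
  orbit-sym (zero  , refl) = zero , refl
  orbit-sym {x} (suc k , eq)   = orbit-trans (orbit-sym (k , eq)) (period x)

  conn⇒orbit : ∀ {x y} → Conn f x y → Orbit f x y
  conn⇒orbit = EC.fold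
    (record { refl = 0 , refl ; sym = orbit-sym ; trans = orbit-trans })
    (λ eq → 1 , eq)

  preimage : ∀ z → ∃[ p ] f p ≡ z
  preimage z = let (k , eq) = period z in
    iterate f z k , trans (sym (iterate-suc f z k)) eq


-- Composing a permutation with a transposition

module _ (x y : Fin n) where

  transpose-cases : ∀ w → (w ≡ x × transpose x y w ≡ y) ⊎
                          (w ≡ y × transpose x y w ≡ x) ⊎
                          (w ≢ x × w ≢ y × transpose x y w ≡ w)
  transpose-cases w with w ≟ x
  ... | yes w≡x = inj₁ (w≡x , refl)
  ... | no w≢x with w ≟ y
  ...   | yes w≡y = inj₂ (inj₁ (w≡y , refl))
  ...   | no w≢y  = inj₂ (inj₂ (w≢x , w≢y , refl))

  transpose-left : transpose x y x ≡ y
  transpose-left with transpose-cases x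
  ... | inj₁ (_ , eq)               = eq
  ... | inj₂ (inj₁ (x≡y , eq))      = trans eq x≡y
  ... | inj₂ (inj₂ (x≢x , _))       = contradiction refl x≢x

  transpose-right : transpose x y y ≡ x
  transpose-right with transpose-cases y
  ... | inj₁ (y≡x , eq)             = trans eq y≡x
  ... | inj₂ (inj₁ (_ , eq))        = eq
  ... | inj₂ (inj₂ (_ , y≢y , _))   = contradiction refl y≢y

  transpose-other : ∀ {w} → w ≢ x → w ≢ y → transpose x y w ≡ w
  transpose-other {w} w≢x w≢y with transpose-cases w
  ... | inj₁ (w≡x , _)               = contradiction w≡x w≢x
  ... | inj₂ (inj₁ (w≡y , _))        = contradiction w≡y w≢y
  ... | inj₂ (inj₂ (_ , _ , eq))     = eq

  transpose-related : {E : Rel (Fin n) 0ℓ} → IsEquivalence E → E x y →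
                      ∀ w → E w (transpose x y w)
  transpose-related {E} E-equiv Exy w with transpose-cases w
  ... | inj₁ (refl , eq)            = subst (E w) (sym eq) Exy
  ... | inj₂ (inj₁ (refl , eq))     = subst (E w) (sym eq) (IsEquivalence.sym E-equiv Exy)
  ... | inj₂ (inj₂ (_ , _ , eq))    = IsEquivalence.reflexive E-equiv (sym eq)

  transpose-injective : Inj (transpose x y)
  transpose-injective {u} {v} eq = begin
    u                                  ≡⟨ transpose-inverse y x ⟨
    transpose y x (transpose x y u)    ≡⟨ cong (transpose y x) eq ⟩
    transpose y x (transpose x y v)    ≡⟨ transpose-inverse y x ⟩
    v                                  ∎
    where open ≡-Reasoning

  module _ {f : Fin n → Fin n} (inj : Inj f) where

    f∘τ : Fin n → Fin n
    f∘τ = f ∘ transpose x y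

    f∘τ-injective : Inj f∘τ
    f∘τ-injective = transpose-injective ∘ inj

    -- The new permutation sends `x` to `f y` and then follows the old cycle of `y`. That cycle
    -- avoids `x`, so nothing on it changes before `y` is reached.
    transpose-merges : ¬ Conn f x y → Conn f∘τ x y
    transpose-merges x≁y = let (k , eq) = period inj y in
      EC.return (cong f transpose-left) ◅◅ walk k eq (x≁y ∘ flipped)
      where
      flipped : Conn f (f y) x → Conn f x y
      flipped fy~x = EC.symmetric _ (EC.return refl ◅◅ fy~x)

      walk : ∀ k {w} → iterate f w k ≡ y → ¬ Conn f w x → Conn f∘τ w y
      walk zero    refl _    = ε
      walk (suc k) {w} eq w≁x with w ≟ y
      ... | yes refl = ε
      ... | no w≢y =
        EC.return (cong f (transpose-other (λ { refl → w≁x ε }) w≢y)) ◅◅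
        walk k eq (λ fw~x → w≁x (EC.return refl ◅◅ fw~x))

    private
      -- The f-path from w meets y before it meets x.
      data Hits : Fin n → Set where
        here  : Hits y
        there : ∀ {w} → w ≢ x → w ≢ y → Hits (f w) → Hits w

      -- If the path meets `x` first, the part after `x` is used instead, which starts at `f x`.
      hits : ∀ k w → iterate f w k ≡ y → Hits w ⊎ Hits (f x)
      hits zero    w refl = inj₁ here
      hits (suc k) w eq with w ≟ y | w ≟ x | hits k (f w) eq
      ... | yes refl | _        | _       = inj₁ here
      ... | no _     | yes refl | inj₁ h  = inj₂ h
      ... | no w≢y   | no w≢x   | inj₁ h  = inj₁ (there w≢x w≢y h)
      ... | no _     | _        | inj₂ h  = inj₂ h

    -- `Hits` is closed under the new permutation: `y` now goes to `f x`, which hits `y` because the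
    -- old cycle leads from `x` to `y`, and its other members move as before. It contains `y` but
    -- not `x`.
    transpose-separates : x ≢ y → Conn f x y → ¬ Conn f∘τ x y
    transpose-separates x≢y x~y x~′y =
      ¬hits-x (closed (orbit-sym f∘τ-injective (conn⇒orbit f∘τ-injective x~′y)) here)
      where
      hits-fx : Hits (f x)
      hits-fx with conn⇒orbit inj x~y
      ... | zero  , x≡y = contradiction x≡y x≢y
      ... | suc k , eq with hits k (f x) eq
      ...   | inj₁ h = h
      ...   | inj₂ h = h

      ¬hits-x : ¬ Hits x
      ¬hits-x here            = x≢y refl
      ¬hits-x (there x≢x _ _) = x≢x refl

      closed₁ : ∀ {w} → Hits w → Hits (f∘τ w)
      closed₁ here = subst (Hits ∘ f) (sym transpose-right) hits-fx
      closed₁ (there w≢x w≢y h) = subst (Hits ∘ f) (sym (transpose-other w≢x w≢y)) h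

      closed : ∀ {w z} → Orbit f∘τ w z → Hits w → Hits z
      closed (zero  , refl) h = h
      closed (suc k , eq)   h = closed (k , eq) (closed₁ h)

  module _ (f : Fin n → Fin n) where

    -- `f u` is the image of `transpose x y u` under the composite, and the transposition moves
    -- points only within `T`. With `compose-τ`: modulo the pair `(x , y)`, the transposition
    -- changes no connections.
    undo-τ : {T : Rel (Fin n) 0ℓ} → IsEquivalence T →
                   (∀ {u v} → f (transpose x y u) ≡ v → T u v) → T x y →
                   ∀ {u v} → f u ≡ v → T u v
    undo-τ {T} E f∘τ⇒T Txy {u} {v} eq = IsEquivalence.trans E
      (transpose-related E Txy u)
      (f∘τ⇒T (trans (cong f involutive) eq))
      where
      involutive : transpose x y (transpose x y u) ≡ u
      involutive with transpose-cases u
      ... | inj₁ (refl , τ≡)        = trans (cong (transpose x y) τ≡) transpose-right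
      ... | inj₂ (inj₁ (refl , τ≡)) = trans (cong (transpose x y) τ≡) transpose-left
      ... | inj₂ (inj₂ (_ , _ , τ≡)) = trans (cong (transpose x y) τ≡) τ≡

    compose-τ : {T : Rel (Fin n) 0ℓ} → IsEquivalence T →
               (∀ {u v} → f u ≡ v → T u v) → T x y →
               ∀ {u v} → f (transpose x y u) ≡ v → T u v
    compose-τ E f⇒T Txy {u} eq =
      IsEquivalence.trans E (transpose-related E Txy u) (f⇒T eq)

    conn-∘τ : Conn f x y → ∀ {u v} → f (transpose x y u) ≡ v → Conn f u v
    conn-∘τ = compose-τ (EC.isEquivalence _) EC.return

-- Hypermaps and their Euler characteristic

cycle? : (f : Fin n → Fin n) → Decidable (λ x y → f x ≡ y)
cycle? f x y = f x ≟ y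

cycles : (Fin n → Fin n) → ℕ
cycles f = count (cycle? f)

Arrow : (f g : A → A) → Rel A 0ℓ
Arrow f g x y = f x ≡ y ⊎ g x ≡ y

arrow? : (f g : Fin n → Fin n) → Decidable (Arrow f g)
arrow? f g x y = (f x ≟ y) ⊎-dec (g x ≟ y)

components : (f g : Fin n → Fin n) → ℕ
components f g = count (arrow? f g)

record Hypermap (n : ℕ) : Set where
  constructor hypermap
  field
    {α σ}       : Fin n → Fin n
    α-injective : Inj α
    σ-injective : Inj σ

  gain loss : ℕ
  gain = cycles α + cycles σ + cycles (σ ∘ α)
  loss = n + 2 * components α σ

open Hypermap using (gain; loss)

infix 4 _⊑_

-- gain - loss is the Euler characteristic less twice the number of components:
-- without fixed points of α, n is twice the number of edges.
_⊑_ : Hypermap m → Hypermap n → Set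
H ⊑ K = gain H + loss K ≤ gain K + loss H

⊑-trans : (G : Hypermap k) (H : Hypermap m) (K : Hypermap n) → G ⊑ H → H ⊑ K → G ⊑ K
⊑-trans G H K p q = ℕ.+-cancelʳ-≤ (gain H + loss H) _ _ (begin
  (gain G + loss K) + (gain H + loss H) ≡⟨ shuffle (gain G) (loss K) (gain H) (loss H) ⟩
  (gain G + loss H) + (gain H + loss K) ≤⟨ ℕ.+-mono-≤ p q ⟩
  (gain H + loss G) + (gain K + loss H) ≡⟨ shuffle′ (gain H) (loss G) (gain K) (loss H) ⟩
  (gain K + loss G) + (gain H + loss H) ∎)
  where
  open ℕ.≤-Reasoning
  shuffle : ∀ a b c d → (a + b) + (c + d) ≡ (a + d) + (c + b)
  shuffle = solve-∀
  shuffle′ : ∀ a b c d → (a + b) + (c + d) ≡ (c + b) + (a + d)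
  shuffle′ = solve-∀

-- The bound `loss ≤ gain`, genus at most zero, passes from the smaller to the larger side of `⊑`;
-- the opposite bound, in `⊑-bound`, passes the other way.
⊑-spherical : (H : Hypermap m) (K : Hypermap n) → H ⊑ K → loss H ≤ gain H → loss K ≤ gain K
⊑-spherical H K p q = ℕ.+-cancelˡ-≤ (loss H) _ _ (begin
  loss H + loss K ≤⟨ ℕ.+-monoˡ-≤ (loss K) q ⟩
  gain H + loss K ≤⟨ p ⟩
  gain K + loss H ≡⟨ ℕ.+-comm (gain K) _ ⟩
  loss H + gain K ∎)
  where open ℕ.≤-Reasoning

⊑-bound : (H : Hypermap m) (K : Hypermap n) → H ⊑ K → gain K ≤ loss K → gain H ≤ loss H
⊑-bound H K p q = ℕ.+-cancelʳ-≤ (loss K) _ _ (begin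
  gain H + loss K ≤⟨ p ⟩
  gain K + loss H ≤⟨ ℕ.+-monoˡ-≤ (loss H) q ⟩
  loss K + loss H ≡⟨ ℕ.+-comm (loss K) _ ⟩
  loss H + loss K ∎)
  where open ℕ.≤-Reasoning

module _ {a b : Fin n → Fin n} (a-inj : Inj a) (b-inj : Inj b) {x y : Fin n} where

  private
    τ = transpose x y

    sum : cycles a + cycles (b ∘ a) + 2 * components (a ∘ τ) b ≤
          cycles (a ∘ τ) + cycles (b ∘ a ∘ τ) + 2 * components a b →
          hypermap a-inj b-inj ⊑ hypermap (f∘τ-injective x y a-inj) b-inj
    sum p = begin
      cycles a + cycles b + cycles (b ∘ a) + (n + 2 * components (a ∘ τ) b)
        ≡⟨ shuffle (cycles a) (cycles b) _ n (components (a ∘ τ) b) ⟩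
      cycles a + cycles (b ∘ a) + 2 * components (a ∘ τ) b + (cycles b + n)
        ≤⟨ ℕ.+-monoˡ-≤ (cycles b + n) p ⟩
      cycles (a ∘ τ) + cycles (b ∘ a ∘ τ) + 2 * components a b + (cycles b + n)
        ≡⟨ shuffle (cycles (a ∘ τ)) (cycles b) _ n (components a b) ⟨
      cycles (a ∘ τ) + cycles b + cycles (b ∘ a ∘ τ) + (n + 2 * components a b) ∎
      where
      open ℕ.≤-Reasoning
      shuffle : ∀ p q r s t → p + q + r + (s + 2 * t) ≡ p + r + 2 * t + (q + s)
      shuffle = solve-∀

    ba-inj : Inj (b ∘ a)
    ba-inj = a-inj ∘ b-inj

    arrow-equiv : (f g : Fin n → Fin n) → IsEquivalence (EqClosure (Arrow f g))
    arrow-equiv f g = EC.isEquivalence (Arrow f g)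

    components-≤ : EqClosure (Arrow (a ∘ τ) b) x y → components (a ∘ τ) b ≤ components a b
    components-≤ x~y = count-antitone (arrow? a b) (arrow? (a ∘ τ) b) λ where
      (inj₁ eq) → undo-τ x y a (arrow-equiv _ _) (EC.return ∘ inj₁) x~y eq
      (inj₂ eq) → EC.return (inj₂ eq)

    components-≤-suc : components (a ∘ τ) b ≤ suc (components a b)
    components-≤-suc = count-join (arrow? (a ∘ τ) b) (arrow? a b) {x} {y} λ where
      E ⇒T Txy (inj₁ eq) → undo-τ x y a E (⇒T ∘ inj₁) Txy eq
      E ⇒T Txy (inj₂ eq) → ⇒T (inj₂ eq)

  -- The transposition splits a cycle of a.  It either splits a cycle of b ∘ a
  -- as well, and disconnects at most one component, or merges two cycles of
  -- b ∘ a, and leaves x and y connected.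
  split-cycle : Conn a x y → hypermap a-inj b-inj ⊑ hypermap (f∘τ-injective x y a-inj) b-inj
  split-cycle x~y with x ≟ y
  ... | yes refl = sum (ℕ.+-mono-≤
      (ℕ.+-mono-≤ (count-antitone (cycle? (a ∘ τ)) (cycle? a) (conn-∘τ x y a ε))
                  (count-antitone (cycle? (b ∘ a ∘ τ)) (cycle? (b ∘ a)) (conn-∘τ x y (b ∘ a) ε)))
      (ℕ.*-monoʳ-≤ 2 (components-≤ ε)))
  ... | no x≢y = sum (helper (connected? (cycle? (b ∘ a ∘ τ)) x y))
    where
    gain-a : cycles a < cycles (a ∘ τ)
    gain-a = count-strict (cycle? (a ∘ τ)) (cycle? a) (conn-∘τ x y a x~y) x~y
      (transpose-separates x y a-inj x≢y x~y)

    helper : Dec (Conn (b ∘ a ∘ τ) x y) →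
             cycles a + cycles (b ∘ a) + 2 * components (a ∘ τ) b ≤
             cycles (a ∘ τ) + cycles (b ∘ a ∘ τ) + 2 * components a b
    helper (yes x~′y) = ℕ.+-mono-≤ (ℕ.≤-pred (begin
        suc (cycles a) + cycles (b ∘ a)             ≤⟨ ℕ.+-mono-≤ gain-a join-ba ⟩
        cycles (a ∘ τ) + suc (cycles (b ∘ a ∘ τ))   ≡⟨ ℕ.+-suc _ _ ⟩
        suc (cycles (a ∘ τ) + cycles (b ∘ a ∘ τ))   ∎))
      (ℕ.*-monoʳ-≤ 2 (components-≤
        (EC.fold (arrow-equiv _ _)
          (λ { refl → EC.return (inj₁ refl) ◅◅ EC.return (inj₂ refl) }) x~′y)))
      where
      open ℕ.≤-Reasoning
      join-ba : cycles (b ∘ a) ≤ suc (cycles (b ∘ a ∘ τ))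
      join-ba = count-join (cycle? (b ∘ a)) (cycle? (b ∘ a ∘ τ)) {x} {y}
        λ E ⇒T Txy → compose-τ x y (b ∘ a) E ⇒T Txy
    -- Two cycles are gained, which pays for a possible new component at its weight 2.
    helper (no x≁′y) = begin
      cycles a + cycles (b ∘ a) + 2 * components (a ∘ τ) b
        ≤⟨ ℕ.+-monoʳ-≤ _ (ℕ.*-monoʳ-≤ 2 components-≤-suc) ⟩
      cycles a + cycles (b ∘ a) + 2 * suc (components a b)
        ≡⟨ shuffle (cycles a) (cycles (b ∘ a)) (components a b) ⟩
      suc (cycles a) + suc (cycles (b ∘ a)) + 2 * components a b
        ≤⟨ ℕ.+-monoˡ-≤ _ (ℕ.+-mono-≤ gain-a gain-ba) ⟩
      cycles (a ∘ τ) + cycles (b ∘ a ∘ τ) + 2 * components a b ∎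
      where
      open ℕ.≤-Reasoning
      shuffle : ∀ p q r → p + q + 2 * suc r ≡ suc p + suc q + 2 * r
      shuffle = solve-∀

      -- Had `b ∘ a` kept `x` and `y` apart, the transposition would have joined them.
      x~ba-y : Conn (b ∘ a) x y
      x~ba-y with connected? (cycle? (b ∘ a)) x y
      ... | yes x~y = x~y
      ... | no x≁y  = contradiction (transpose-merges x y ba-inj x≁y) x≁′y

      gain-ba : cycles (b ∘ a) < cycles (b ∘ a ∘ τ)
      gain-ba = count-strict (cycle? (b ∘ a ∘ τ)) (cycle? (b ∘ a))
        (conn-∘τ x y (b ∘ a) x~ba-y) x~ba-y x≁′y

-- Duality and the removal of points

⊑-intro : (H : Hypermap m) (K : Hypermap n) → gain H ≤ gain K → loss K ≤ loss H → H ⊑ K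
⊑-intro H K = ℕ.+-mono-≤

cycles-cong : {f g : Fin n → Fin n} → f ≗ g → cycles f ≤ cycles g
cycles-cong {f = f} {g} f≗g = count-antitone (cycle? g) (cycle? f)
  λ {x} eq → EC.return (trans (f≗g x) eq)

-- `f` conjugates `g ∘ f` into `f ∘ g`, so the classes are pulled back along `f`.
cycles-commute : {f g : Fin n → Fin n} → Inj f → cycles (f ∘ g) ≡ cycles (g ∘ f)
cycles-commute {n = n} {f = f} {g} f-inj = count-unique (cycle? (g ∘ f))
  (c ∘ f , onto′ , λ x y → mk⇔ (back ∘ to (c⇔ _ _)) (from (c⇔ _ _) ∘ EC.gmap f (cong f)))
  where
  c = proj₁ (count-classes (cycle? (f ∘ g)))
  c-onto = proj₁ (proj₂ (count-classes (cycle? (f ∘ g))))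
  c⇔ = proj₂ (proj₂ (count-classes (cycle? (f ∘ g))))

  onto′ : StrictlySurjective _≡_ (c ∘ f)
  onto′ i = let (u , cu≡i) = c-onto i ; (v , fv≡u) = preimage f-inj u in
    v , trans (cong c fv≡u) cu≡i

  back : ∀ {x y} → Conn (f ∘ g) (f x) (f y) → Conn (g ∘ f) x y
  back {x} {y} fx~fy =
    EC.return refl ◅◅ EC.gmap g (cong g) fx~fy ◅◅ EC.symmetric _ (EC.return refl)

⊑-swap : {a b : Fin n → Fin n} (a-inj : Inj a) (b-inj : Inj b) →
         hypermap a-inj b-inj ⊑ hypermap b-inj a-inj
⊑-swap {n = n} {a} {b} a-inj b-inj =
  ⊑-intro (hypermap a-inj b-inj) (hypermap b-inj a-inj)
    (ℕ.+-mono-≤ (ℕ.≤-reflexive (ℕ.+-comm (cycles a) (cycles b)))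
                (ℕ.≤-reflexive (cycles-commute b-inj)))
    (ℕ.+-monoʳ-≤ n (ℕ.*-monoʳ-≤ 2 (count-antitone (arrow? a b) (arrow? b a) λ where
      (inj₁ eq) → EC.return (inj₂ eq)
      (inj₂ eq) → EC.return (inj₁ eq))))

-- Passage to the dual map: vertices and faces change places, since `φ ∘ α` is `σ` again for an
-- involution `α`.
⊑-rotate : {α σ φ : Fin n → Fin n} (α-inj : Inj α) (σ-inj : Inj σ) (φ-inj : Inj φ) →
           (∀ d → α (α d) ≡ d) → φ ≗ σ ∘ α →
           hypermap α-inj σ-inj ⊑ hypermap α-inj φ-inj
⊑-rotate {n = n} {α} {σ} {φ} α-inj σ-inj φ-inj αα φ≗σα =
  ⊑-intro (hypermap α-inj σ-inj) (hypermap α-inj φ-inj)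
    (begin
      cycles α + cycles σ + cycles (σ ∘ α)
        ≤⟨ ℕ.+-mono-≤ (ℕ.+-monoʳ-≤ (cycles α) (cycles-cong σ≗φα)) (cycles-cong (sym ∘ φ≗σα)) ⟩
      cycles α + cycles (φ ∘ α) + cycles φ
        ≡⟨ shuffle (cycles α) _ _ ⟩
      cycles α + cycles φ + cycles (φ ∘ α) ∎)
    (ℕ.+-monoʳ-≤ n (ℕ.*-monoʳ-≤ 2 (count-antitone (arrow? α σ) (arrow? α φ) λ where
      (inj₁ eq)       → EC.return (inj₁ eq)
      {x} (inj₂ refl) → EC.return (inj₁ refl) ◅◅ EC.return (inj₂ (sym (σ≗φα x))))))
  where
  open ℕ.≤-Reasoning
  σ≗φα : σ ≗ φ ∘ α
  σ≗φα d = trans (cong σ (sym (αα d))) (sym (φ≗σα (α d)))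
  shuffle : ∀ p q r → p + q + r ≡ p + r + q
  shuffle = solve-∀

-- `z` is related to nothing but possibly itself and forms a class alone: it gets the class `zero`,
-- and the other classes move up by one.
count-isolated : {P : Rel (Fin (suc n)) 0ℓ} {Q : Rel (Fin n) 0ℓ}
  (P? : Decidable P) (Q? : Decidable Q) (z : Fin (suc n)) →
  (∀ {i j} → Q i j → P (punchIn z i) (punchIn z j)) →
  (∀ {i j} → P (punchIn z i) (punchIn z j) → Q i j) →
  (∀ {w} → P z w → z ≡ w) → (∀ {w} → P w z → z ≡ w) →
  count P? ≡ suc (count Q?)
count-isolated {n} {P} {Q} P? Q? z Q⇒P P⇒Q z-out z-in =
  sym (count-unique P? (class , onto′ , λ x y → mk⇔ (sound x y)
    (EC.fold (kernel-equiv class) (λ {x} {y} → complete x y))))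
  where
  c = proj₁ (count-classes Q?)
  c-onto = proj₁ (proj₂ (count-classes Q?))
  c⇔ = proj₂ (proj₂ (count-classes Q?))

  class : Fin (suc n) → Fin (suc (count Q?))
  class w with z ≟ w
  ... | yes _  = zero
  ... | no z≢w = suc (c (punchOut z≢w))

  class-punchIn : ∀ i → class (punchIn z i) ≡ suc (c i)
  class-punchIn i with z ≟ punchIn z i
  ... | yes eq = contradiction (sym eq) (punchInᵢ≢i z i)
  ... | no _   = cong (suc ∘ c) (trans (punchOut-cong z refl) (punchOut-punchIn z))

  class-z : class z ≡ zero
  class-z with z ≟ z
  ... | yes _  = refl
  ... | no z≢z = contradiction refl z≢z

  onto′ : StrictlySurjective _≡_ class
  onto′ zero    = z , class-z
  onto′ (suc i) = let (u , cu≡i) = c-onto i in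
    punchIn z u , trans (class-punchIn u) (cong suc cu≡i)

  sound : ∀ x y → class x ≡ class y → EqClosure P x y
  sound x y eq with z ≟ x | z ≟ y
  ... | yes refl | yes refl = ε
  ... | no z≢x | no z≢y = subst₂ (EqClosure P) (punchIn-punchOut z≢x) (punchIn-punchOut z≢y)
    (EC.gmap (punchIn z) Q⇒P (to (c⇔ _ _) (suc-injective eq)))

  complete : ∀ x y → P x y → class x ≡ class y
  complete x y Pxy with z ≟ x | z ≟ y
  ... | yes _    | yes _    = refl
  ... | yes refl | no z≢y   = contradiction (z-out Pxy) z≢y
  ... | no z≢x   | yes refl = contradiction (z-in Pxy) z≢x
  ... | no z≢x   | no z≢y   = cong suc (from (c⇔ _ _) (EC.return (P⇒Q
    (subst₂ P (sym (punchIn-punchOut z≢x)) (sym (punchIn-punchOut z≢y)) Pxy))))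

module _ {f : Fin (suc n) → Fin (suc n)} {g : Fin n → Fin n} {z : Fin (suc n)}
         (fz≡z : f z ≡ z) (pg≗fp : ∀ i → punchIn z (g i) ≡ f (punchIn z i))
         (f-inj : Inj f) where

  step-out : ∀ {w} → f z ≡ w → z ≡ w
  step-out = trans (sym fz≡z)

  step-in : ∀ {w} → f w ≡ z → z ≡ w
  step-in fw≡z = f-inj (trans fz≡z (sym fw≡z))

  step-up : ∀ {i j} → g i ≡ j → f (punchIn z i) ≡ punchIn z j
  step-up {i} eq = trans (sym (pg≗fp i)) (cong (punchIn z) eq)

  step-down : ∀ {i j} → f (punchIn z i) ≡ punchIn z j → g i ≡ j
  step-down {i} {j} eq = punchIn-injective z (g i) j (trans (pg≗fp i) eq)

  cycles-isolated : cycles f ≡ suc (cycles g)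
  cycles-isolated =
    count-isolated (cycle? f) (cycle? g) z step-up step-down step-out step-in

-- The fixed point accounts for three units in each quantity: a cycle of `a`, of `b` and of `b ∘ a`
-- in `gain`, and a point and a component of weight 2 in `loss`.
⊑-restrict : {a b : Fin (suc n) → Fin (suc n)} {a′ b′ : Fin n → Fin n} {z : Fin (suc n)}
  (a-inj : Inj a) (b-inj : Inj b) (a′-inj : Inj a′) (b′-inj : Inj b′) →
  a z ≡ z → b z ≡ z →
  (∀ i → punchIn z (a′ i) ≡ a (punchIn z i)) →
  (∀ i → punchIn z (b′ i) ≡ b (punchIn z i)) →
  hypermap a-inj b-inj ⊑ hypermap a′-inj b′-inj
⊑-restrict {n} {a} {b} {a′} {b′} {z} a-inj b-inj a′-inj b′-inj az bz pa pb = ℕ.≤-reflexive (begin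
  cycles a + cycles b + cycles (b ∘ a) + (n + 2 * components a′ b′)
    ≡⟨ cong₂ (λ p q → p + q + (n + 2 * components a′ b′))
        (cong₂ _+_ (cycles-isolated az pa a-inj) (cycles-isolated bz pb b-inj))
        (cycles-isolated (trans (cong b az) bz)
          (λ i → trans (pb (a′ i)) (cong b (pa i))) (a-inj ∘ b-inj)) ⟩
  suc (cycles a′) + suc (cycles b′) + suc (cycles (b′ ∘ a′)) + (n + 2 * components a′ b′)
    ≡⟨ shuffle (cycles a′) (cycles b′) (cycles (b′ ∘ a′)) n (components a′ b′) ⟩
  cycles a′ + cycles b′ + cycles (b′ ∘ a′) + (suc n + 2 * suc (components a′ b′))
    ≡⟨ cong (λ p → cycles a′ + cycles b′ + cycles (b′ ∘ a′) + (suc n + 2 * p)) components-isolated ⟨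
  cycles a′ + cycles b′ + cycles (b′ ∘ a′) + (suc n + 2 * components a b) ∎)
  where
  open ≡-Reasoning
  shuffle : ∀ p q r s t → suc p + suc q + suc r + (s + 2 * t) ≡ p + q + r + (suc s + 2 * suc t)
  shuffle = solve-∀

  components-isolated : components a b ≡ suc (components a′ b′)
  components-isolated = count-isolated (arrow? a b) (arrow? a′ b′) z
    (λ { (inj₁ eq) → inj₁ (step-up az pa a-inj eq) ; (inj₂ eq) → inj₂ (step-up bz pb b-inj eq) })
    (λ { (inj₁ eq) → inj₁ (step-down az pa a-inj eq) ; (inj₂ eq) → inj₂ (step-down bz pb b-inj eq) })
    (λ { (inj₁ eq) → step-out az pa a-inj eq ; (inj₂ eq) → step-out bz pb b-inj eq })
    (λ { (inj₁ eq) → step-in az pa a-inj eq ; (inj₂ eq) → step-in bz pb b-inj eq })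

-- `z` is cut out of its cycle. `skip` does so on the set without `z`; `isolate` keeps `z` as a
-- fixed point and is `f` composed with a transposition, the form to which `split-cycle` applies.
module Skip {f : Fin (suc n) → Fin (suc n)} (inj : Inj f) (z : Fin (suc n)) where

  private
    leaves : ∀ i → f (punchIn z i) ≡ z → z ≢ f z
    leaves i fi≡z z≡fz = punchInᵢ≢i z i (inj (trans fi≡z z≡fz))

  skip : Fin n → Fin n
  skip i with f (punchIn z i) ≟ z
  ... | yes fi≡z = punchOut (leaves i fi≡z)
  ... | no fi≢z  = punchOut (fi≢z ∘ sym)

  skip-through : ∀ i → f (punchIn z i) ≡ z → punchIn z (skip i) ≡ f z
  skip-through i fi≡z with f (punchIn z i) ≟ z
  ... | yes _   = punchIn-punchOut _
  ... | no fi≢z = contradiction fi≡z fi≢z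

  skip-past : ∀ i → f (punchIn z i) ≢ z → punchIn z (skip i) ≡ f (punchIn z i)
  skip-past i fi≢z with f (punchIn z i) ≟ z
  ... | yes fi≡z = contradiction fi≡z fi≢z
  ... | no _     = punchIn-punchOut _

  before : Fin (suc n)
  before = proj₁ (preimage inj z)

  f-before : f before ≡ z
  f-before = proj₂ (preimage inj z)

  isolate : Fin (suc n) → Fin (suc n)
  isolate = f∘τ before z inj

  isolate-injective : Inj isolate
  isolate-injective = f∘τ-injective before z inj

  isolate-z : isolate z ≡ z
  isolate-z = trans (cong f (transpose-right before z)) f-before

  skip-isolate : ∀ i → punchIn z (skip i) ≡ isolate (punchIn z i)
  skip-isolate i with f (punchIn z i) ≟ z in eq
  ... | yes fi≡z = trans (punchIn-punchOut _) (cong f (begin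
    z                                ≡⟨ transpose-left before z ⟨
    transpose before z before        ≡⟨ cong (transpose before z) (inj (trans f-before (sym fi≡z))) ⟩
    transpose before z (punchIn z i) ∎))
    where open ≡-Reasoning
  ... | no fi≢z  = trans (punchIn-punchOut _) (cong f (sym (transpose-other before z
    (λ i≡before → fi≢z (trans (cong f i≡before) f-before)) (punchInᵢ≢i z i))))

  skip-injective : Inj skip
  skip-injective {i} {j} eq = punchIn-injective z i j (isolate-injective
    (trans (sym (skip-isolate i)) (trans (cong (punchIn z) eq) (skip-isolate j))))

  skip⇒conn : ∀ {i j} → Conn skip i j → Conn f (punchIn z i) (punchIn z j)
  skip⇒conn = EC.gfold (EC.isEquivalence _) (punchIn z) λ {i} → λ where
    refl → subst (Conn f (punchIn z i)) (sym (skip-isolate i))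
             (conn-∘τ before z f (EC.return f-before) refl)

  conn⇒skip : ∀ {i j} → Conn f (punchIn z i) (punchIn z j) → Conn skip i j
  conn⇒skip {i} {j} i~j = let (k , eq) = conn⇒orbit inj i~j in walk k i eq
    where
    walk : ∀ k i → iterate f (punchIn z i) k ≡ punchIn z j → Conn skip i j
    walk zero    i eq = subst (Conn skip i) (punchIn-injective z i j eq) ε
    walk (suc k) i eq with f (punchIn z i) ≟ z
    walk (suc k)       i eq | no fi≢z  = EC.return refl ◅◅
      walk k (skip i) (trans (cong (λ w → iterate f w k) (skip-past i fi≢z)) eq)
    walk (suc zero)    i eq | yes fi≡z =
      contradiction (trans (sym eq) fi≡z) (punchInᵢ≢i z j)
    -- The path runs through `z`, so one step of `skip` covers two of `f`.
    walk (suc (suc k)) i eq | yes fi≡z = EC.return refl ◅◅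
      walk k (skip i) (trans
        (cong (λ w → iterate f w k) (trans (skip-through i fi≡z) (cong f (sym fi≡z)))) eq)

  skip-involutive : (∀ d → f (f d) ≡ d) → ∀ i → skip (skip i) ≡ i
  skip-involutive ff i = by-cases (f (punchIn z i) ≟ z)
    where
    by-cases : Dec (f (punchIn z i) ≡ z) → skip (skip i) ≡ i
    by-cases (yes fi≡z) = trans (cong skip skip-i) skip-i
      where
      skip-i : skip i ≡ i
      skip-i = punchIn-injective z _ i
        (trans (skip-through i fi≡z) (trans (cong f (sym fi≡z)) (ff _)))
    by-cases (no fi≢z) = punchIn-injective z _ i (trans
      (skip-past (skip i) (λ eq → punchInᵢ≢i z i (trans (sym f-skip-i) eq))) f-skip-i)
      where
      f-skip-i : f (punchIn z (skip i)) ≡ punchIn z i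
      f-skip-i = trans (cong f (skip-past i fi≢z)) (ff _)

module _ {a b : Fin (suc n) → Fin (suc n)} (a-inj : Inj a) (b-inj : Inj b) (z : Fin (suc n)) where

  private
    module a = Skip a-inj z
    module b = Skip b-inj z

  ⊑-skip : hypermap a-inj b-inj ⊑ hypermap a.skip-injective b.skip-injective
  ⊑-skip =
    ⊑-trans ab a′b ↾ (split-cycle a-inj b-inj (EC.return a.f-before))
    (⊑-trans a′b ba′ ↾ (⊑-swap a.isolate-injective b-inj)
    (⊑-trans ba′ b′a′ ↾ (split-cycle b-inj a.isolate-injective (EC.return b.f-before))
    (⊑-trans b′a′ a′b′ ↾ (⊑-swap b.isolate-injective a.isolate-injective)
    (⊑-restrict a.isolate-injective b.isolate-injective a.skip-injective b.skip-injective
      a.isolate-z b.isolate-z a.skip-isolate b.skip-isolate))))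
    where
    ab   = hypermap a-inj b-inj
    a′b  = hypermap a.isolate-injective b-inj
    ba′  = hypermap b-inj a.isolate-injective
    b′a′ = hypermap b.isolate-injective a.isolate-injective
    a′b′ = hypermap a.isolate-injective b.isolate-injective
    ↾    = hypermap a.skip-injective b.skip-injective

count≤n : {Q : Rel (Fin n) 0ℓ} (Q? : Decidable Q) → count Q? ≤ n
count≤n Q? = let (c , onto , _) = count-classes Q? in
  injective⇒≤ {f = proj₁ ∘ onto}
    λ {i} {j} eq → trans (sym (proj₂ (onto i))) (trans (cong c eq) (proj₂ (onto j)))

genus≥0 : (H : Hypermap n) → gain H ≤ loss H
genus≥0 {zero} (hypermap {α} {σ} _ _) = ℕ.≤-trans
  (ℕ.+-mono-≤ (ℕ.+-mono-≤ (count≤n (cycle? α)) (count≤n (cycle? σ))) (count≤n (cycle? (σ ∘ α))))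
  z≤n
genus≥0 {suc n} H@(hypermap α-inj σ-inj) =
  ⊑-bound H H′ (⊑-skip α-inj σ-inj zero) (genus≥0 H′)
  where H′ = hypermap (Skip.skip-injective α-inj zero) (Skip.skip-injective σ-inj zero)

-- Drawings of graphs

-- A spherical hypermap with involution α, possibly with fixed points, loops and
-- parallel edges, in which every vertex of G is placed at a label, i.e. a cycle
-- of σ (or an unused label).  Cycles of σ that do not carry a vertex are
-- ignored, so that an induced subgraph inherits the hypermap unchanged.
record Drawing (G : GraphOn n) : Set where
  field
    {darts labels} : ℕ
    {α σ}       : Fin darts → Fin darts
    α-injective : Inj α
    σ-injective : Inj σ
    involutive  : ∀ d → α (α d) ≡ d
    spherical   : loss (hypermap α-injective σ-injective) ≤ gain (hypermap α-injective σ-injective)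
    label       : Fin darts → Fin labels
    label⇔      : ∀ d e → label d ≡ label e ⇔ Conn σ d e
    place       : Fin n → Fin labels
    place-injective : Inj place
    edges       : ∀ u v → Adj G u v ⇔
                  (u ≢ v × ∃[ d ] label d ≡ place u × label (α d) ≡ place v)

drawing-pullback : {K : GraphOn m} {G : GraphOn n} (f : Fin m → Fin n) → Inj f →
                   (∀ u v → adj K u v ≡ adj G (f u) (f v)) → Drawing G → Drawing K
drawing-pullback f f-inj f-adj D = record
  { α-injective = α-injective ; σ-injective = σ-injective
  ; involutive = involutive ; spherical = spherical
  ; label = label ; label⇔ = label⇔
  ; place = place ∘ f
  ; place-injective = f-inj ∘ place-injective
  ; edges = λ u v → mk⇔
      (λ Kuv → let (fu≢fv , d) = to (edges (f u) (f v)) (subst T (f-adj u v) Kuv) in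
        (λ u≡v → fu≢fv (cong f u≡v)) , d)
      (λ (u≢v , d) → subst T (sym (f-adj u v)) (from (edges (f u) (f v)) (u≢v ∘ f-inj , d)))
  }
  where open Drawing D

contract-adj : (G : GraphOn (suc n)) (u v : Fin (suc n)) (i j : Fin n) →
  Adj (contract G u v) i j ⇔
  (i ≢ j × (Adj G (punchIn v i) (punchIn v j) ⊎
            (punchIn v i ≡ u × Adj G v (punchIn v j)) ⊎
            (punchIn v j ≡ u × Adj G v (punchIn v i))))
contract-adj G u v i j with i ≟ j
... | yes i≡j = mk⇔ (λ ()) (λ (i≢j , _) → i≢j i≡j)
... | no i≢j  = mk⇔
  (λ t → i≢j , Sum.map₂ (Sum.map witness witness ∘ to T-∨) (to T-∨ t))
  (λ (_ , s) → from T-∨ (Sum.map₂ (from T-∨ ∘ Sum.map unwitness unwitness) s))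
  where
  witness : ∀ {w b} → T (does (w ≟ u) ∧ b) → w ≡ u × T b
  witness {w} t with w ≟ u
  ... | yes w≡u = w≡u , t

  unwitness : ∀ {w b} → w ≡ u × T b → T (does (w ≟ u) ∧ b)
  unwitness {w} (w≡u , t) with w ≟ u
  ... | yes _  = t
  ... | no w≢u = contradiction w≡u w≢u

-- Composing α and σ with the transposition of d and α d leaves σ ∘ α unchanged
-- and merges the endpoints of the edge d.
module _ {α σ : Fin n → Fin n} (α-inj : Inj α) (σ-inj : Inj σ)
         (αα : ∀ d → α (α d) ≡ d) (d : Fin n) where

  private
    τ = transpose d (α d)

  α∘τ-other : ∀ {e} → e ≢ d → e ≢ α d → α (τ e) ≡ α e
  α∘τ-other e≢d e≢αd = cong α (transpose-other d (α d) e≢d e≢αd)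

  α∘τ-left : α (τ d) ≡ d
  α∘τ-left = trans (cong α (transpose-left d (α d))) (αα d)

  α∘τ-right : α (τ (α d)) ≡ α d
  α∘τ-right = cong α (transpose-right d (α d))

  α∘τ-involutive : ∀ e → α (τ (α (τ e))) ≡ e
  α∘τ-involutive e = by-cases (e ≟ d) (e ≟ α d)
    where
    by-cases : Dec (e ≡ d) → Dec (e ≡ α d) → α (τ (α (τ e))) ≡ e
    by-cases (yes refl) _ = trans (cong (α ∘ τ) α∘τ-left) α∘τ-left
    by-cases _ (yes refl) = trans (cong (α ∘ τ) α∘τ-right) α∘τ-right
    by-cases (no e≢d) (no e≢αd) = begin
      α (τ (α (τ e)))  ≡⟨ cong (α ∘ τ) (α∘τ-other e≢d e≢αd) ⟩
      α (τ (α e))      ≡⟨ α∘τ-other (λ αe≡d → e≢αd (trans (sym (αα e)) (cong α αe≡d))) (e≢d ∘ α-inj) ⟩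
      α (α e)          ≡⟨ αα e ⟩
      e                ∎
      where open ≡-Reasoning

  -- Contraction is deletion in the dual: there the cycle of `α` through `d` is split, and dualizing
  -- back yields `σ` composed with the same transposition.
  ⊑-contract : hypermap α-inj σ-inj ⊑
    hypermap (f∘τ-injective d (α d) α-inj) (f∘τ-injective d (α d) σ-inj)
  ⊑-contract =
    ⊑-trans (hypermap α-inj σ-inj) (hypermap α-inj φ-inj) K
      (⊑-rotate α-inj σ-inj φ-inj αα (λ _ → refl))
    (⊑-trans (hypermap α-inj φ-inj) (hypermap α′-inj φ-inj) K
      (split-cycle α-inj φ-inj (EC.return refl))
      (⊑-rotate α′-inj φ-inj (f∘τ-injective d (α d) σ-inj) α∘τ-involutive
        (λ e → cong σ (sym (αα (τ e))))))
    where
    φ-inj : Inj (σ ∘ α)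
    φ-inj = α-inj ∘ σ-inj
    α′-inj = f∘τ-injective d (α d) α-inj
    K = hypermap α′-inj (f∘τ-injective d (α d) σ-inj)

-- Some dart `d` of the drawing represents the edge. After the contraction `d` and `α d` stay as
-- fixed points of the new involution, the cycles of `σ` at `u` and `v` are one, and the label of
-- `v` falls out of use.
drawing-contract : (G : GraphOn (suc n)) (u v : Fin (suc n)) → Adj G u v →
                   Drawing G → Drawing (contract G u v)
drawing-contract {n} G u v Guv D = record
  { α-injective = f∘τ-injective d (α d) α-injective
  ; σ-injective = f∘τ-injective d (α d) σ-injective
  ; involutive  = α∘τ-involutive α-injective σ-injective involutive d
  ; spherical   = ⊑-spherical (hypermap α-injective σ-injective)
      (hypermap (f∘τ-injective d (α d) α-injective) (f∘τ-injective d (α d) σ-injective))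
      (⊑-contract α-injective σ-injective involutive d) spherical
  ; label       = relabel ∘ label
  ; label⇔      = λ e e′ → mk⇔ (relabel⇒conn e e′ ∘ relabel-kernel (label e) (label e′))
      (EC.fold (kernel-equiv (relabel ∘ label)) (λ { {x} refl → conn⇒relabel x }))
  ; place       = place ∘ punchIn v
  ; place-injective = punchIn-injective v _ _ ∘ place-injective
  ; edges       = λ i j → mk⇔
      (edge⇒ i j ∘ to (contract-adj G u v i j))
      (from (contract-adj G u v i j) ∘ edge⇐ i j)
  }
  where
  open Drawing D

  u≢v : u ≢ v
  u≢v = proj₁ (to (edges u v) Guv)
  d = proj₁ (proj₂ (to (edges u v) Guv))
  d-label : label d ≡ place u
  d-label = proj₁ (proj₂ (proj₂ (to (edges u v) Guv)))
  αd-label : label (α d) ≡ place v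
  αd-label = proj₂ (proj₂ (proj₂ (to (edges u v) Guv)))

  τ = transpose d (α d)

  relabel : Fin labels → Fin labels
  relabel l with l ≟ place v
  ... | yes _ = place u
  ... | no _  = l

  relabel-v : relabel (place v) ≡ place u
  relabel-v with place v ≟ place v
  ... | yes _ = refl
  ... | no ≢  = contradiction refl ≢

  relabel-other : ∀ {l} → l ≢ place v → relabel l ≡ l
  relabel-other {l} l≢ with l ≟ place v
  ... | yes l≡ = contradiction l≡ l≢
  ... | no _   = refl

  relabel-u : relabel (place u) ≡ place u
  relabel-u = relabel-other (u≢v ∘ place-injective)

  relabel-inverse : ∀ {l l′} → relabel l ≡ l′ → l ≡ l′ ⊎ (l ≡ place v × l′ ≡ place u)
  relabel-inverse {l} eq with l ≟ place v
  ... | yes l≡ = inj₂ (l≡ , sym eq)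
  ... | no _   = inj₁ eq

  relabel-kernel : ∀ l l′ → relabel l ≡ relabel l′ →
    l ≡ l′ ⊎ (l ≡ place u × l′ ≡ place v) ⊎ (l ≡ place v × l′ ≡ place u)
  relabel-kernel l l′ eq with l ≟ place v | l′ ≟ place v
  ... | yes l≡ | yes l′≡ = inj₁ (trans l≡ (sym l′≡))
  ... | yes l≡ | no _    = inj₂ (inj₂ (l≡ , sym eq))
  ... | no _   | yes l′≡ = inj₂ (inj₁ (eq , l′≡))
  ... | no _   | no _    = inj₁ eq

  d~′αd : Conn (σ ∘ τ) d (α d)
  d~′αd = transpose-merges d (α d) σ-injective λ d~αd →
    u≢v (place-injective (trans (sym d-label) (trans (from (label⇔ _ _) d~αd) αd-label)))

  σ⇒σ′ : ∀ {e e′} → Conn σ e e′ → Conn (σ ∘ τ) e e′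
  σ⇒σ′ = EC.fold (EC.isEquivalence _)
    (undo-τ d (α d) σ (EC.isEquivalence _) EC.return d~′αd)

  same : ∀ {e e′} → label e ≡ label e′ → Conn (σ ∘ τ) e e′
  same = σ⇒σ′ ∘ to (label⇔ _ _)

  relabel⇒conn : ∀ e e′ → label e ≡ label e′ ⊎
    (label e ≡ place u × label e′ ≡ place v) ⊎ (label e ≡ place v × label e′ ≡ place u) →
    Conn (σ ∘ τ) e e′
  relabel⇒conn e e′ (inj₁ eq) = same eq
  relabel⇒conn e e′ (inj₂ (inj₁ (eu , e′v))) =
    same (trans eu (sym d-label)) ◅◅ d~′αd ◅◅ same (trans αd-label (sym e′v))
  relabel⇒conn e e′ (inj₂ (inj₂ (ev , e′u))) =
    same (trans ev (sym αd-label)) ◅◅ EC.symmetric _ d~′αd ◅◅ same (trans d-label (sym e′u))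

  conn⇒relabel : ∀ e → relabel (label e) ≡ relabel (label (σ (τ e)))
  conn⇒relabel e = compose-τ d (α d) σ (kernel-equiv (relabel ∘ label))
    (λ { refl → cong relabel (from (label⇔ _ _) (EC.return refl)) })
    (begin
      relabel (label d)      ≡⟨ cong relabel d-label ⟩
      relabel (place u)      ≡⟨ relabel-u ⟩
      place u                ≡⟨ relabel-v ⟨
      relabel (place v)      ≡⟨ cong relabel αd-label ⟨
      relabel (label (α d))  ∎) refl
    where open ≡-Reasoning

  place≢ : ∀ i → place (punchIn v i) ≢ place v
  place≢ i = punchInᵢ≢i v i ∘ place-injective

  place≡ : ∀ {i j} → place (punchIn v i) ≡ place (punchIn v j) → i ≡ j
  place≡ = punchIn-injective v _ _ ∘ place-injective

  Ends : (e : Fin darts) (x y : Fin labels) → Set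
  Ends e x y = relabel (label e) ≡ x × relabel (label (α (τ e))) ≡ y

  -- After relabelling, `e` has distinct ends, while both ends of `d` carry the label of `u`. So `e`
  -- is neither `d` nor `α d`, and the new involution agrees with `α` on it.
  kept : ∀ {e i j x y} → i ≢ j →
         label e ≡ x → label (α e) ≡ y →
         relabel x ≡ place (punchIn v i) → relabel y ≡ place (punchIn v j) →
         Ends e (place (punchIn v i)) (place (punchIn v j))
  kept {e} {i} {j} {x} {y} i≢j ex αey x→ y→ =
    trans (cong relabel ex) x→ ,
    trans (cong (relabel ∘ label) (α∘τ-other α-injective σ-injective involutive d e≢d e≢αd))
      (trans (cong relabel αey) y→)
    where
    e≢d : e ≢ d
    e≢d refl = i≢j (place≡ (begin
      place (punchIn v i)     ≡⟨ x→ ⟨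
      relabel x               ≡⟨ cong relabel (trans (sym ex) d-label) ⟩
      relabel (place u)       ≡⟨ trans relabel-u (sym relabel-v) ⟩
      relabel (place v)       ≡⟨ cong relabel (trans (sym αd-label) αey) ⟩
      relabel y               ≡⟨ y→ ⟩
      place (punchIn v j)     ∎))
      where open ≡-Reasoning

    e≢αd : e ≢ α d
    e≢αd refl = i≢j (place≡ (begin
      place (punchIn v i)     ≡⟨ x→ ⟨
      relabel x               ≡⟨ cong relabel (trans (sym ex) αd-label) ⟩
      relabel (place v)       ≡⟨ trans relabel-v (sym relabel-u) ⟩
      relabel (place u)       ≡⟨ cong relabel (trans (sym d-label) (trans (cong label (sym (involutive d))) αey)) ⟩
      relabel y               ≡⟨ y→ ⟩
      place (punchIn v j)     ∎))
      where open ≡-Reasoning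

  edge⇒ : ∀ i j → i ≢ j × (Adj G (punchIn v i) (punchIn v j) ⊎
            (punchIn v i ≡ u × Adj G v (punchIn v j)) ⊎
            (punchIn v j ≡ u × Adj G v (punchIn v i))) →
          i ≢ j × ∃[ e ] Ends e (place (punchIn v i)) (place (punchIn v j))
  edge⇒ i j (i≢j , inj₁ Gij) =
    let (_ , e , ei , αej) = to (edges _ _) Gij in
    i≢j , e , kept i≢j ei αej (relabel-other (place≢ i)) (relabel-other (place≢ j))
  edge⇒ i j (i≢j , inj₂ (inj₁ (i≡u , Gvj))) =
    let (_ , e , ev , αej) = to (edges _ _) Gvj in
    i≢j , e , kept i≢j ev αej (trans relabel-v (cong place (sym i≡u))) (relabel-other (place≢ j))
  edge⇒ i j (i≢j , inj₂ (inj₂ (j≡u , Gvi))) =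
    let (_ , e , ei , αev) = to (edges _ _) (subst T (symmetric G _ _) Gvi) in
    i≢j , e , kept i≢j ei αev (relabel-other (place≢ i)) (trans relabel-v (cong place (sym j≡u)))

  edge⇐ : ∀ i j → i ≢ j × ∃[ e ] Ends e (place (punchIn v i)) (place (punchIn v j)) →
          i ≢ j × (Adj G (punchIn v i) (punchIn v j) ⊎
            (punchIn v i ≡ u × Adj G v (punchIn v j)) ⊎
            (punchIn v j ≡ u × Adj G v (punchIn v i)))
  edge⇐ i j (i≢j , e , ei , α′ej) = i≢j , by-cases (e ≟ d) (e ≟ α d)
    where
    fixed : α (τ e) ≡ e → ⊥
    fixed α′e≡e = i≢j (place≡ (trans (sym ei) (trans (cong (relabel ∘ label) (sym α′e≡e)) α′ej)))

    by-cases : Dec (e ≡ d) → Dec (e ≡ α d) → _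
    by-cases (yes refl) _ = ⊥-elim (fixed (α∘τ-left α-injective σ-injective involutive d))
    by-cases _ (yes refl) = ⊥-elim (fixed (α∘τ-right α-injective σ-injective involutive d))
    by-cases (no e≢d) (no e≢αd)
      with relabel-inverse ei
         | relabel-inverse (trans (cong (relabel ∘ label)
             (sym (α∘τ-other α-injective σ-injective involutive d e≢d e≢αd))) α′ej)
    ... | inj₁ ei | inj₁ αej =
      inj₁ (from (edges _ _) (i≢j ∘ punchIn-injective v i j , e , ei , αej))
    ... | inj₂ (ev , i≡u) | inj₁ αej =
      inj₂ (inj₁ (place-injective i≡u ,
        from (edges _ _) (punchInᵢ≢i v j ∘ sym , e , ev , αej)))
    ... | inj₁ ei | inj₂ (αev , j≡u) =
      inj₂ (inj₂ (place-injective j≡u ,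
        subst T (symmetric G _ _) (from (edges _ _) (punchInᵢ≢i v i , e , ei , αev))))
    ... | inj₂ (_ , i≡u) | inj₂ (_ , j≡u) =
      ⊥-elim (i≢j (place≡ (trans i≡u (sym j≡u))))

-- Embeddings of the darts of a graph in a hypermap

Onto : (A → B) → Set
Onto f = StrictlySurjective _≡_ f

module _ {G : GraphOn n} where

  dart-≡ : {d e : Dart G} → tail d ≡ tail e → head d ≡ head e → d ≡ e
  dart-≡ {dart u v p} {dart u v q} refl refl = cong (dart u v) (T-irrelevant p q)

  reverse-involutive : (d : Dart G) → reverse (reverse d) ≡ d
  reverse-involutive d = dart-≡ refl refl

  tail≢head : (d : Dart G) → tail d ≢ head d
  tail≢head (dart u u p) refl = subst T (irreflexive G u) p

  anyDart? : {P : Dart G → Set} → (∀ d → Dec (P d)) → Dec (∃ P)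
  anyDart? {P} P? = map′
    (λ (u , v , p , Pd) → dart u v p , Pd)
    (λ (d , Pd) → tail d , head d , adjacent d , Pd)
    (any? λ u → any? λ v → at u v)
    where
    at : ∀ u v → Dec (∃[ p ] P (dart u v p))
    at u v with T? (adj G u v)
    ... | no ¬p = no (¬p ∘ proj₁)
    ... | yes p = map′ (p ,_) (λ (q , Pd) → subst (P ∘ dart u v) (T-irrelevant q p) Pd)
                       (P? (dart u v p))

  onImage? : (ι : Dart G → Fin m) → ∀ z → Dec (∃[ d ] ι d ≡ z)
  onImage? ι z = anyDart? (λ d → ι d ≟ z)

  onto-or-miss : (ι : Dart G → Fin m) → Onto ι ⊎ (∃[ z ] ∀ d → z ≢ ι d)
  onto-or-miss ι with any? (λ z → ¬? (onImage? ι z))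
  ... | yes (z , z∉) = inj₂ (z , λ d z≡ → z∉ (d , sym z≡))
  ... | no ¬miss     = inj₁ λ z → decidable-stable (onImage? ι z) (λ z∉ → ¬miss (z , z∉))

  -- Values missed by `ι` are punched out one at a time; thus a crude injection suffices to number
  -- the darts.
  number : ∀ m (ι : Dart G → Fin m) → Inj ι → ∃[ k ] Σ[ κ ∈ (Dart G → Fin k) ] Inj κ × Onto κ
  number m ι ι-inj with onto-or-miss ι
  ... | inj₁ onto = m , ι , ι-inj , onto
  number zero    ι ι-inj | inj₂ (() , _)
  number (suc m) ι ι-inj | inj₂ (z , z≢ι) =
    number m (λ d → punchOut (z≢ι d)) (ι-inj ∘ punchOut-injective (z≢ι _) (z≢ι _))

  record Embedding (ι : Dart G → Fin m) (α σ : Fin m → Fin m) : Set where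
    field
      ι-injective : Inj ι
      ι-reverse   : ∀ d → ι (reverse d) ≡ α (ι d)
      involutive  : ∀ d → α (α d) ≡ d
      σ-injective : Inj σ
      tails       : ∀ d e → tail d ≡ tail e ⇔ Conn σ (ι d) (ι e)

    α-injective : Inj α
    α-injective {x} {y} eq = trans (sym (involutive x)) (trans (cong α eq) (involutive y))

    field
      spherical   : loss (hypermap α-injective σ-injective) ≤ gain (hypermap α-injective σ-injective)

  FullEmbedding : Set
  FullEmbedding = ∃[ m ] Σ[ ι ∈ (Dart G → Fin m) ] ∃[ α ] ∃[ σ ] Embedding ι α σ × Onto ι

  -- Dropping a missed point `z` keeps the hypermap spherical by `⊑-skip`. `α` maps the image of `ι`
  -- into itself, so it is unchanged there; cutting `z` out of a cycle of `σ` leaves the other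
  -- points of the cycle together.
  shrink : ∀ m {ι : Dart G → Fin m} {α σ} → Embedding ι α σ → FullEmbedding
  shrink m {ι} M with onto-or-miss ι
  ... | inj₁ onto = m , ι , _ , _ , M , onto
  shrink zero    M | inj₂ (() , _)
  shrink (suc m) {ι} {α} {σ} M | inj₂ (z , z≢ι) = shrink m {ι′} {α.skip} {σ.skip} record
    { ι-injective = ι-injective ∘ punchOut-injective (z≢ι _) (z≢ι _)
    ; ι-reverse   = λ d → punchIn-injective z _ _ (begin
        punchIn z (ι′ (reverse d))   ≡⟨ punchIn-ι′ (reverse d) ⟩
        ι (reverse d)                ≡⟨ α-punchIn d ⟨
        α (punchIn z (ι′ d))         ≡⟨ α.skip-past (ι′ d)
                                          (λ eq → z≢ι (reverse d) (trans (sym eq) (α-punchIn d))) ⟨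
        punchIn z (α.skip (ι′ d))    ∎)
    ; involutive  = α.skip-involutive involutive
    ; σ-injective = σ.skip-injective
    ; tails       = λ d e → mk⇔
        (λ eq → σ.conn⇒skip (subst₂ (Conn σ) (sym (punchIn-ι′ d)) (sym (punchIn-ι′ e)) (to (tails d e) eq)))
        (λ d~e → from (tails d e) (subst₂ (Conn σ) (punchIn-ι′ d) (punchIn-ι′ e) (σ.skip⇒conn d~e)))
    ; spherical   = ⊑-spherical (hypermap α-injective σ-injective)
        (hypermap α.skip-injective σ.skip-injective) (⊑-skip α-injective σ-injective z) spherical
    }
    where
    open Embedding M
    open ≡-Reasoning
    module α = Skip α-injective z
    module σ = Skip σ-injective z

    ι′ : Dart G → Fin m
    ι′ d = punchOut (z≢ι d)

    punchIn-ι′ : ∀ d → punchIn z (ι′ d) ≡ ι d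
    punchIn-ι′ d = punchIn-punchOut (z≢ι d)

    α-punchIn : ∀ d → α (punchIn z (ι′ d)) ≡ ι (reverse d)
    α-punchIn d = trans (cong α (punchIn-ι′ d)) (sym (ι-reverse d))

  drawing⇒embedding : Drawing G → FullEmbedding
  drawing⇒embedding D = shrink darts {ι} record
    { ι-injective = λ {d} {e} eq → dart-≡
        (place-injective (trans (sym (ι-tail d)) (trans (cong label eq) (ι-tail e))))
        (place-injective (trans (sym (ι-head d)) (trans (cong (label ∘ α) eq) (ι-head e))))
    ; ι-reverse   = ι-reverse
    ; involutive  = involutive
    ; σ-injective = σ-injective
    ; tails       = λ d e → mk⇔
        (λ eq → to (label⇔ _ _) (trans (ι-tail d) (trans (cong place eq) (sym (ι-tail e)))))
        (λ d~e → place-injective (trans (sym (ι-tail d)) (trans (from (label⇔ _ _) d~e) (ι-tail e))))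
    ; spherical   = spherical
    }
    where
    open Drawing D

    edge : ∀ u v → Adj G u v → Fin darts
    edge u v p = proj₁ (proj₂ (to (edges u v) p))

    edge-tail : ∀ u v p → label (edge u v p) ≡ place u
    edge-tail u v p = proj₁ (proj₂ (proj₂ (to (edges u v) p)))

    edge-head : ∀ u v p → label (α (edge u v p)) ≡ place v
    edge-head u v p = proj₂ (proj₂ (proj₂ (to (edges u v) p)))

    -- Parallel edges of the drawing force a choice, made once for the two darts
    -- of an edge of G.
    ι : Dart G → Fin darts
    ι d with <-cmp (tail d) (head d)
    ... | tri< _ _ _ = edge (tail d) (head d) (adjacent d)
    ... | tri≈ _ _ _ = edge (tail d) (head d) (adjacent d)
    ... | tri> _ _ _ = α (edge (head d) (tail d) (adjacent (reverse d)))

    ι-reverse : ∀ d → ι (reverse d) ≡ α (ι d)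
    ι-reverse d with <-cmp (tail d) (head d) | <-cmp (head d) (tail d)
    ... | tri≈ _ u≡v _ | _              = contradiction u≡v (tail≢head d)
    ... | _            | tri≈ _ v≡u _   = contradiction (sym v≡u) (tail≢head d)
    ... | tri< u<v _ _ | tri< v<u _ _   = contradiction u<v (<-asym v<u)
    ... | tri> _ _ v<u | tri> _ _ u<v   = contradiction v<u (<-asym u<v)
    ... | tri> _ _ _   | tri< _ _ _     = sym (involutive _)
    ... | tri< _ _ _   | tri> _ _ _     =
      cong (α ∘ edge (tail d) (head d)) (T-irrelevant _ _)

    ι-tail : ∀ d → label (ι d) ≡ place (tail d)
    ι-tail d with <-cmp (tail d) (head d)
    ... | tri< _ _ _ = edge-tail _ _ _
    ... | tri≈ _ _ _ = edge-tail _ _ _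
    ... | tri> _ _ _ = edge-head _ _ _

    ι-head : ∀ d → label (α (ι d)) ≡ place (head d)
    ι-head d = trans (cong label (sym (ι-reverse d))) (ι-tail (reverse d))

-- Between rotation systems and embeddings

module Conjugate {ι : A → Fin m} (ι-inj : Inj ι) (onto : Onto ι)
                 {f : A → A} {g : Fin m → Fin m} (g-inj : Inj g)
                 (ι-f : ∀ x → ι (f x) ≡ g (ι x)) where

  ι-iterate : ∀ x k → ι (iterate f x k) ≡ iterate g (ι x) k
  ι-iterate x zero    = refl
  ι-iterate x (suc k) = trans (ι-iterate (f x) k) (cong (λ y → iterate g y k) (ι-f x))

  orbit⇔conn : ∀ x y → Orbit f x y ⇔ Conn g (ι x) (ι y)
  orbit⇔conn x y = mk⇔
    (λ (k , eq) → orbit⇒conn (k , trans (sym (ι-iterate x k)) (cong ι eq)))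
    (λ x~y → let (k , eq) = conn⇒orbit g-inj x~y in k , ι-inj (trans (ι-iterate x k) eq))

classes-pullback : {ι : A → B} → Onto ι → {R : Rel A 0ℓ} {S : Rel B 0ℓ} →
  (∀ x y → R x y ⇔ S (ι x) (ι y)) → HasClasses S k → HasClasses R k
classes-pullback {ι = ι} onto R⇔S (c , c-onto , c⇔) = c ∘ ι ,
  (λ i → let (b , cb≡i) = c-onto i ; (a , ιa≡b) = onto b in a , trans (cong c ιa≡b) cb≡i) ,
  λ x y → mk⇔ (from (R⇔S x y) ∘ to (c⇔ _ _)) (from (c⇔ _ _) ∘ to (R⇔S x y))

-- A section of `f` is an injective map of a finite set to itself, hence onto, and `f` is injective
-- on its values.
onto⇒injective : {f : Fin n → Fin n} → Onto f → Inj f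
onto⇒injective {f = f} onto {x} {y} fx≡fy =
  let (x′ , sx′≡x) = preimage section-injective x
      (y′ , sy′≡y) = preimage section-injective y
  in begin
    x                 ≡⟨ sx′≡x ⟨
    section x′        ≡⟨ cong section (begin
      x′              ≡⟨ proj₂ (onto x′) ⟨
      f (section x′)  ≡⟨ cong f sx′≡x ⟩
      f x             ≡⟨ fx≡fy ⟩
      f y             ≡⟨ cong f sy′≡y ⟨
      f (section y′)  ≡⟨ proj₂ (onto y′) ⟩
      y′              ∎) ⟩
    section y′        ≡⟨ sy′≡y ⟩
    y                 ∎
  where
  open ≡-Reasoning
  section : Fin _ → Fin _
  section = proj₁ ∘ onto
  section-injective : Inj section
  section-injective {i} {j} eq = trans (sym (proj₂ (onto i))) (trans (cong f eq) (proj₂ (onto j)))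

-- The cycles of a fixed-point-free involution are pairs; each pair is ordered
-- by <, and Fin 2 tells the smaller element from the larger one.
involution-cycles : {α : Fin n → Fin n} → (∀ d → α (α d) ≡ d) → (∀ d → α d ≢ d) →
                    cycles α * 2 ≡ n
involution-cycles {n} {α} αα α≢ = ℕ.≤-antisym
  (injective⇒≤ {f = choose} choose-injective) (injective⇒≤ {f = rank} rank-injective)
  where
  c = proj₁ (count-classes (cycle? α))
  c-onto = proj₁ (proj₂ (count-classes (cycle? α)))
  c⇔ = proj₂ (proj₂ (count-classes (cycle? α)))

  cycle-pair : ∀ {x y} → Conn α x y → y ≡ x ⊎ y ≡ α x
  cycle-pair = EC.fold {S = λ x y → y ≡ x ⊎ y ≡ α x}
    (record
      { refl  = inj₁ refl
      ; sym   = λ { (inj₁ refl) → inj₁ refl ; (inj₂ refl) → inj₂ (sym (αα _)) }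
      ; trans = λ { (inj₁ refl) q → q ; (inj₂ refl) (inj₁ refl) → inj₂ refl
                  ; (inj₂ refl) (inj₂ refl) → inj₁ (αα _) } })
    (inj₂ ∘ sym)

  side : Fin n → Fin 2
  side x with <-cmp x (α x)
  ... | tri< _ _ _ = zero
  ... | tri≈ _ _ _ = zero
  ... | tri> _ _ _ = suc zero

  side-α : ∀ x → side x ≢ side (α x)
  side-α x eq with <-cmp x (α x) | <-cmp (α x) (α (α x))
  ... | tri≈ _ x≡αx _ | _ = α≢ x (sym x≡αx)
  ... | _ | tri≈ _ αx≡ααx _ = α≢ (α x) (sym αx≡ααx)
  ... | tri< x<αx _ _ | tri< αx<ααx _ _ = <-asym x<αx (subst (α x Fin.<_) (αα x) αx<ααx)
  ... | tri> _ _ αx<x | tri> _ _ ααx<αx = <-asym αx<x (subst (Fin._< α x) (αα x) ααx<αx)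
  ... | tri< _ _ _ | tri> _ _ _ with () ← eq
  ... | tri> _ _ _ | tri< _ _ _ with () ← eq

  rank : Fin n → Fin (cycles α * 2)
  rank x = combine (c x) (side x)

  rank-injective : Inj rank
  rank-injective {x} {y} eq
    with cycle-pair (to (c⇔ x y) (combine-injectiveˡ (c x) (side x) (c y) (side y) eq))
  ... | inj₁ refl = refl
  ... | inj₂ refl = contradiction (combine-injectiveʳ (c x) (side x) (c y) (side y) eq) (side-α x)

  pick : Fin (cycles α) → Fin 2 → Fin n
  pick i zero       = proj₁ (c-onto i)
  pick i (suc zero) = α (proj₁ (c-onto i))

  c-pick : ∀ i b → c (pick i b) ≡ i
  c-pick i zero       = proj₂ (c-onto i)
  c-pick i (suc zero) = trans (from (c⇔ _ _) (EC.symmetric _ (EC.return refl))) (proj₂ (c-onto i))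

  pick-injective : ∀ p p′ → uncurry pick p ≡ uncurry pick p′ → p ≡ p′
  pick-injective (i , b) (i′ , b′) eq
    with refl ← trans (sym (c-pick i b)) (trans (cong c eq) (c-pick i′ b′)) =
    cong (i ,_) (same-side b b′ eq)
    where
    same-side : ∀ b b′ → pick i b ≡ pick i b′ → b ≡ b′
    same-side zero       zero       _  = refl
    same-side zero       (suc zero) eq = contradiction (sym eq) (α≢ _)
    same-side (suc zero) zero       eq = contradiction eq (α≢ _)
    same-side (suc zero) (suc zero) _  = refl

  choose : Fin (cycles α * 2) → Fin n
  choose j = uncurry pick (remQuot 2 j)

  choose-injective : Inj choose
  choose-injective {j} {j′} eq = begin
    j                                            ≡⟨ combine-remQuot {cycles α} 2 j ⟨
    uncurry combine (remQuot {cycles α} 2 j)     ≡⟨ cong (uncurry combine) (pick-injective (remQuot 2 j) (remQuot 2 j′) eq) ⟩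
    uncurry combine (remQuot {cycles α} 2 j′)    ≡⟨ combine-remQuot {cycles α} 2 j′ ⟩
    j′                                           ∎
    where open ≡-Reasoning

module _ {G : GraphOn n} {ι : Dart G → Fin m} (ι-inj : Inj ι) (onto : Onto ι)
         {α : Fin m → Fin m} (ι-reverse : ∀ d → ι (reverse d) ≡ α (ι d)) where

  private
    ι⁻¹ : Fin m → Dart G
    ι⁻¹ = proj₁ ∘ onto

    ι-ι⁻¹ : ∀ i → ι (ι⁻¹ i) ≡ i
    ι-ι⁻¹ = proj₂ ∘ onto

    ι⁻¹-ι : ∀ d → ι⁻¹ (ι d) ≡ d
    ι⁻¹-ι d = ι-inj (ι-ι⁻¹ (ι d))

    α-ι⁻¹ : ∀ i → α i ≡ ι (reverse (ι⁻¹ i))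
    α-ι⁻¹ i = trans (cong α (sym (ι-ι⁻¹ i))) (sym (ι-reverse _))

  reverse⇒involutive : ∀ i → α (α i) ≡ i
  reverse⇒involutive i = begin
    α (α i)                           ≡⟨ cong α (α-ι⁻¹ i) ⟩
    α (ι (reverse (ι⁻¹ i)))           ≡⟨ ι-reverse _ ⟨
    ι (reverse (reverse (ι⁻¹ i)))     ≡⟨ cong ι (reverse-involutive (ι⁻¹ i)) ⟩
    ι (ι⁻¹ i)                         ≡⟨ ι-ι⁻¹ i ⟩
    i                                 ∎
    where open ≡-Reasoning

  reverse⇒injective : Inj α
  reverse⇒injective {x} {y} eq =
    trans (sym (reverse⇒involutive x)) (trans (cong α eq) (reverse⇒involutive y))

  -- No dart is its own reverse, since its tail and head differ. Hence the term `n` of `loss` is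
  -- twice the number of edges.
  dart-count : cycles α * 2 ≡ m
  dart-count = involution-cycles reverse⇒involutive λ i αi≡i →
    tail≢head (ι⁻¹ i) (sym (cong tail (ι-inj (trans (trans (sym (α-ι⁻¹ i)) αi≡i) (sym (ι-ι⁻¹ i))))))

  edge-classes : HasClasses (Orbit (reverse {G = G})) (cycles α)
  edge-classes = classes-pullback onto
    (Conjugate.orbit⇔conn ι-inj onto reverse⇒injective ι-reverse) (count-classes (cycle? α))

  module _ {σ : Fin m → Fin m}
           (tails : ∀ d e → tail d ≡ tail e ⇔ Conn σ (ι d) (ι e)) where

    -- An edge of a path is followed by turning about its tail with `σ` and crossing with `α`.
    -- Conversely, `σ` stays at a vertex and `α` moves along an edge.
    component⇔ : ∀ d e → Star (Adj G) (tail d) (tail e) ⇔ EqClosure (Arrow α σ) (ι d) (ι e)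
    component⇔ d e = mk⇔ (λ path → walk path d refl refl)
      (λ d~e → subst₂ (λ d e → Star (Adj G) (tail d) (tail e)) (ι⁻¹-ι d) (ι⁻¹-ι e)
        (EC.gfold path-equiv (tail ∘ ι⁻¹) arrow⇒path d~e))
      where
      path-equiv : IsEquivalence (Star (Adj G))
      path-equiv = record
        { refl = ε ; sym = Star.reverse (λ {u} {v} → subst T (symmetric G u v)) ; trans = _◅◅_ }

      σ⇒arrow : ∀ {i j} → Conn σ i j → EqClosure (Arrow α σ) i j
      σ⇒arrow = EC.map inj₂

      walk : ∀ {u v} → Star (Adj G) u v → ∀ d → tail d ≡ u → v ≡ tail e →
             EqClosure (Arrow α σ) (ι d) (ι e)
      walk ε d refl v≡ = σ⇒arrow (to (tails d e) v≡)
      walk (_◅_ {j = w} p path) d refl v≡ =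
        σ⇒arrow (to (tails d (dart (tail d) w p)) refl) ◅◅
        EC.return (inj₁ (sym (ι-reverse (dart (tail d) w p)))) ◅◅
        walk path (reverse (dart (tail d) w p)) refl v≡

      arrow⇒path : ∀ {i j} → Arrow α σ i j → Star (Adj G) (tail (ι⁻¹ i)) (tail (ι⁻¹ j))
      arrow⇒path {i} (inj₁ refl) = subst (Star (Adj G) (tail (ι⁻¹ i)))
        (cong tail (trans (sym (ι⁻¹-ι _)) (cong ι⁻¹ (sym (α-ι⁻¹ i)))))
        (adjacent (ι⁻¹ i) ◅ ε)
      arrow⇒path {i} (inj₂ refl) = subst (Star (Adj G) (tail (ι⁻¹ i)))
        (from (tails _ _) (subst₂ (Conn σ) (sym (ι-ι⁻¹ i)) (sym (ι-ι⁻¹ (σ i))) (EC.return refl)))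
        ε

    component-classes : HasClasses {Dart G} (λ d e → Star (Adj G) (tail d) (tail e)) (components α σ)
    component-classes = classes-pullback onto component⇔ (count-classes (arrow? α σ))

  module _ {next : Dart G → Dart G} {σ : Fin m → Fin m} (σ-inj : Inj σ)
           (ι-next : ∀ d → ι (next d) ≡ σ (ι d)) where

    private
      module σ = Conjugate ι-inj onto σ-inj ι-next
      module φ = Conjugate ι-inj onto {f = next ∘ reverse} (reverse⇒injective ∘ σ-inj)
        (λ d → trans (ι-next (reverse d)) (cong σ (ι-reverse d)))

    vertex-orbit : ∀ d e → Orbit next d e ⇔ Conn σ (ι d) (ι e)
    vertex-orbit = σ.orbit⇔conn

    vertex-classes : HasClasses (Orbit next) (cycles σ)
    vertex-classes = classes-pullback onto σ.orbit⇔conn (count-classes (cycle? σ))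

    face-classes : HasClasses (Orbit (next ∘ reverse)) (cycles (σ ∘ α))
    face-classes = classes-pullback onto φ.orbit⇔conn (count-classes (cycle? (σ ∘ α)))

  embedding⇒planar : {σ : Fin m → Fin m} → Embedding {G = G} ι α σ → Planar (n , G)
  embedding⇒planar {σ} M = rotation , record
    { vertices = vertex-classes σ-injective ι-next
    ; edges = edge-classes
    ; faces = face-classes σ-injective ι-next
    ; components = component-classes tails
    -- The number `cycles α` of edges occurs once in `gain` and, by `dart-count`, twice in `loss`;
    -- cancelling one copy leaves Euler's formula.
    ; euler = ℕ.+-cancelˡ-≡ (cycles α) _ _ (begin
        cycles α + (cycles σ + cycles (σ ∘ α))   ≡⟨ ℕ.+-assoc (cycles α) _ _ ⟨
        gain H                                   ≡⟨ ℕ.≤-antisym (genus≥0 H) spherical ⟩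
        m + 2 * components α σ                   ≡⟨ cong (_+ 2 * components α σ) dart-count ⟨
        cycles α * 2 + 2 * components α σ        ≡⟨ shuffle (cycles α) _ ⟩
        cycles α + (cycles α + 2 * components α σ) ∎)
    }
    where
    open Embedding M hiding (ι-reverse)
    open ≡-Reasoning
    H = hypermap α-injective σ-injective

    shuffle : ∀ p q → p * 2 + q ≡ p + (p + q)
    shuffle = solve-∀

    next : Dart G → Dart G
    next d = ι⁻¹ (σ (ι d))

    ι-next : ∀ d → ι (next d) ≡ σ (ι d)
    ι-next d = ι-ι⁻¹ _

    rotation : RotationSystem G
    rotation = record
      { next = next
      ; cycles = λ d e → mk⇔
          (from (vertex-orbit σ-injective ι-next d e) ∘ to (tails d e))
          (from (tails d e) ∘ to (vertex-orbit σ-injective ι-next d e)) }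

  planar⇒embedding : (planar : Planar (n , G)) {σ : Fin m → Fin m} →
    (∀ d → ι (RotationSystem.next (proj₁ planar) d) ≡ σ (ι d)) → Embedding {G = G} ι α σ
  planar⇒embedding (R , S) {σ} ι-next = record
    { ι-injective = ι-inj
    ; ι-reverse = ι-reverse
    ; involutive = reverse⇒involutive
    ; σ-injective = σ-inj
    ; tails = tails
    ; spherical = ℕ.≤-reflexive (begin
        m + 2 * components α σ              ≡⟨ cong (_+ 2 * components α σ) dart-count ⟨
        cycles α * 2 + 2 * components α σ   ≡⟨ shuffle (cycles α) _ ⟩
        cycles α + (cycles α + 2 * components α σ)
          ≡⟨ cong₂ (λ p q → cycles α + (p + 2 * q))
               (classes-unique edge-classes S.edges)
               (classes-unique (component-classes tails) S.components) ⟩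
        cycles α + (S.E + 2 * S.C)          ≡⟨ cong (cycles α +_) S.euler ⟨
        cycles α + (S.V + S.F)
          ≡⟨ cong₂ (λ p q → cycles α + (p + q))
               (classes-unique S.vertices (vertex-classes σ-inj ι-next))
               (classes-unique S.faces (face-classes σ-inj ι-next)) ⟩
        cycles α + (cycles σ + cycles (σ ∘ α)) ≡⟨ ℕ.+-assoc (cycles α) _ _ ⟨
        cycles α + cycles σ + cycles (σ ∘ α) ∎)
    }
    where
    open RotationSystem R renaming (cycles to orbits)
    module S = Spherical S
    open ≡-Reasoning

    shuffle : ∀ p q → p * 2 + q ≡ p + (p + q)
    shuffle = solve-∀

    -- `d` and `next d` have the same tail, so the orbit of `next d` returns to `d`; the dart just
    -- before the return is a preimage.
    next-onto : Onto next
    next-onto d with k , eq ← to (orbits (next d) d) (sym (from (orbits d (next d)) (1 , refl))) =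
      iterate next d k , trans (sym (iterate-suc next d k)) eq

    σ-inj : Inj σ
    σ-inj = onto⇒injective λ i → let (d , next-d) = next-onto (ι⁻¹ i) in
      ι d , trans (sym (ι-next d)) (trans (cong ι next-d) (ι-ι⁻¹ i))

    tails : ∀ d e → tail d ≡ tail e ⇔ Conn σ (ι d) (ι e)
    tails d e = mk⇔
      (to (vertex-orbit σ-inj ι-next d e) ∘ to (orbits d e))
      (from (orbits d e) ∘ from (vertex-orbit σ-inj ι-next d e))

  embedding⇒drawing : {σ : Fin m → Fin m} → Embedding {G = G} ι α σ → Drawing G
  embedding⇒drawing {σ} M = record
    { α-injective = α-injective
    ; σ-injective = σ-injective
    ; involutive = involutive
    ; spherical = spherical
    ; label = tail ∘ ι⁻¹
    ; label⇔ = λ i j → mk⇔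
        (subst₂ (Conn σ) (ι-ι⁻¹ i) (ι-ι⁻¹ j) ∘ to (tails _ _))
        (from (tails _ _) ∘ subst₂ (Conn σ) (sym (ι-ι⁻¹ i)) (sym (ι-ι⁻¹ j)))
    ; place = id
    ; place-injective = id
    ; edges = λ u v → mk⇔
        (λ p → tail≢head {G = G} (dart u v p) , ι (dart u v p) ,
               cong tail (ι⁻¹-ι _) ,
               cong tail (trans (cong ι⁻¹ (sym (ι-reverse _))) (ι⁻¹-ι _)))
        (λ (_ , i , tail≡u , head≡v) → subst₂ (Adj G) tail≡u
          (trans (cong tail (trans (sym (ι⁻¹-ι _)) (cong ι⁻¹ (sym (α-ι⁻¹ i))))) head≡v)
          (adjacent (ι⁻¹ i)))
    }
    where open Embedding M hiding (ι-reverse)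

-- Planarity is decidable and minor-closed

allVecs : List A → ∀ n → List (Vec A n)
allVecs xs zero    = [] ∷ []
allVecs xs (suc n) = cartesianProductWith _∷_ xs (allVecs xs n)

∈-allVecs : {xs : List A} → (∀ x → x ∈ˡ xs) → (v : Vec A n) → v ∈ˡ allVecs xs n
∈-allVecs complete []      = here refl
∈-allVecs complete (x ∷ v) = ∈-cartesianProductWith⁺ _∷_ (complete x) (∈-allVecs complete v)

-- Vectors enumerate functions only up to pointwise equality, hence the second hypothesis.
anyFunction? : {P : (Fin m → Fin n) → Set} → (∀ f → Dec (P f)) →
               (∀ {f g} → f ≗ g → P f → P g) → Dec (∃ P)
anyFunction? {m} {n} P? P-resp = map′
  (λ found → let (v , Pv) = Any.satisfied found in lookup v , Pv)
  (λ (f , Pf) → lose (∈-allVecs ∈-allFin (tabulate f))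
    (P-resp (λ i → sym (lookup∘tabulate f i)) Pf))
  (Any.any? (P? ∘ lookup) (allVecs (allFin n) m))

injective? : (f : Fin m → Fin n) → Dec (Inj f)
injective? f = map′ (λ h {i} {j} → h i j) (λ inj i j → inj)
  (all? λ i → all? λ j → (f i ≟ f j) →-dec (i ≟ j))

module _ {G : GraphOn n} {ι : Dart G → Fin m} (ι-inj : Inj ι) (onto : Onto ι)
         {α : Fin m → Fin m} (ι-reverse : ∀ d → ι (reverse d) ≡ α (ι d)) where

  -- The condition on tails is restated for points of `Fin m`, over which quantification is
  -- decidable.
  embedding? : ∀ σ → Dec (Embedding {G = G} ι α σ)
  embedding? σ = map′ assemble conditions
    (injective? σ ×-dec
     all? (λ i → all? λ j →
       ((tail (ι⁻¹ i) ≟ tail (ι⁻¹ j)) →-dec connected? (cycle? σ) i j) ×-dec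
       (connected? (cycle? σ) i j →-dec (tail (ι⁻¹ i) ≟ tail (ι⁻¹ j)))) ×-dec
     (m + 2 * components α σ ℕ.≤? cycles α + cycles σ + cycles (σ ∘ α)))
    where
    ι⁻¹ : Fin m → Dart G
    ι⁻¹ = proj₁ ∘ onto

    ι⁻¹-ι : ∀ d → ι⁻¹ (ι d) ≡ d
    ι⁻¹-ι d = ι-inj (proj₂ (onto (ι d)))

    Conditions : Set
    Conditions = Inj σ ×
      (∀ i j → (tail (ι⁻¹ i) ≡ tail (ι⁻¹ j) → Conn σ i j) ×
               (Conn σ i j → tail (ι⁻¹ i) ≡ tail (ι⁻¹ j))) ×
      m + 2 * components α σ ≤ cycles α + cycles σ + cycles (σ ∘ α)

    assemble : Conditions → Embedding {G = G} ι α σ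
    assemble (σ-inj , tails , spherical) = record
      { ι-injective = ι-inj
      ; ι-reverse   = ι-reverse
      ; involutive  = reverse⇒involutive {G = G} ι-inj onto {α} ι-reverse
      ; σ-injective = σ-inj
      ; tails       = λ d e → let (p , q) = tails (ι d) (ι e) in mk⇔
          (λ eq → p (trans (cong tail (ι⁻¹-ι d)) (trans eq (cong tail (sym (ι⁻¹-ι e))))))
          (λ d~e → trans (cong tail (sym (ι⁻¹-ι d))) (trans (q d~e) (cong tail (ι⁻¹-ι e))))
      ; spherical   = spherical
      }

    conditions : Embedding {G = G} ι α σ → Conditions
    conditions M = σ-injective ,
      (λ i j →
        subst₂ (Conn σ) (proj₂ (onto i)) (proj₂ (onto j)) ∘ to (tails _ _) ,
        from (tails _ _) ∘ subst₂ (Conn σ) (sym (proj₂ (onto i))) (sym (proj₂ (onto j)))) ,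
      spherical
      where open Embedding M

module Numbered (G : GraphOn n) where

  opaque
    numbering : ∃[ k ] Σ[ κ ∈ (Dart G → Fin k) ] Inj κ × Onto κ
    -- A dart is determined by the ordered pair of its ends.
    numbering = number {G = G} (n * n) (λ d → combine (tail d) (head d)) λ {d} {e} eq → dart-≡
      (combine-injectiveˡ (tail d) (head d) (tail e) (head e) eq)
      (combine-injectiveʳ (tail d) (head d) (tail e) (head e) eq)

  size : ℕ
  size = proj₁ numbering

  ι : Dart G → Fin size
  ι = proj₁ (proj₂ numbering)

  ι-injective : Inj ι
  ι-injective = proj₁ (proj₂ (proj₂ numbering))

  ι-onto : Onto ι
  ι-onto = proj₂ (proj₂ (proj₂ numbering))

  conjugate : (Dart G → Dart G) → Fin size → Fin size
  conjugate f i = ι (f (proj₁ (ι-onto i)))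

  ι-conjugate : ∀ f d → ι (f d) ≡ conjugate f (ι d)
  ι-conjugate f d = cong (ι ∘ f) (sym (ι-injective (proj₂ (ι-onto (ι d)))))

  -- `σ` is given only up to pointwise equality, because the search in `planar?` meets it in
  -- tabulated form.
  embedding : (planar : Planar (n , G)) → ∀ {σ} → σ ≗ conjugate (RotationSystem.next (proj₁ planar)) →
              Embedding {G = G} ι (conjugate reverse) σ
  embedding planar σ≗ = planar⇒embedding ι-injective ι-onto (ι-conjugate reverse) planar
    λ d → trans (ι-conjugate (RotationSystem.next (proj₁ planar)) d) (sym (σ≗ (ι d)))

planar⇒drawing : (G : GraphOn n) → Planar (n , G) → Drawing G
planar⇒drawing G planar = embedding⇒drawing ι-injective ι-onto (ι-conjugate reverse)
  (embedding planar (λ _ → refl))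
  where open Numbered G

drawing⇒planar : (G : GraphOn n) → Drawing G → Planar (n , G)
drawing⇒planar G D with m , ι , α , σ , M , onto ← drawing⇒embedding D =
  embedding⇒planar (Embedding.ι-injective M) onto (Embedding.ι-reverse M) M

-- Once the darts are numbered, `α` is determined and `σ` ranges over finitely many maps, which are
-- all tried.
planar? : ∀ G → Dec (Planar G)
planar? (n , G) = map′
  (λ found → let (v , M) = Any.satisfied found in
    embedding⇒planar ι-injective ι-onto (ι-conjugate reverse) M)
  (λ planar → lose (∈-allVecs ∈-allFin (tabulate _))
    (embedding planar (lookup∘tabulate _)))
  (Any.any? (embedding? ι-injective ι-onto (ι-conjugate reverse) ∘ lookup)
    (allVecs (allFin size) size))
  where open Numbered G

drawing-step : ∀ {G H} → Step ops G H → Drawing (proj₂ G) → Drawing (proj₂ H)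
drawing-step (vertexDeletion _ G v)            =
  drawing-pullback (punchIn v) (punchIn-injective v _ _) (λ _ _ → refl)
drawing-step (edgeContraction _ G u v p)       = drawing-contract G u v p
drawing-step (vertexDissolution _ G u v p _ _) = drawing-contract G u v p

planar-≅ : ∀ {G H} → G ≅ H → Planar G → Planar H
planar-≅ {m , G} {n , H} (f , f-adj) planar = drawing⇒planar H
  (drawing-pullback {G = G} (Inverse.from f) from-injective
    (λ u v → sym (trans (f-adj _ _) (cong₂ (adj H) (Inverse.strictlyInverseˡ f u) (Inverse.strictlyInverseˡ f v))))
    (planar⇒drawing G planar))
  where
  from-injective : Inj (Inverse.from f)
  from-injective {u} {v} eq = trans (sym (Inverse.strictlyInverseˡ f u))
    (trans (cong (Inverse.to f) eq) (Inverse.strictlyInverseˡ f v))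

planar-contains : ∀ {G H} → Contains ops G H → Planar G → Planar H
planar-contains {ops} {G} {H} (K , steps , K≅H) planar =
  planar-≅ K≅H (drawing⇒planar (proj₂ K) (walk steps (planar⇒drawing (proj₂ G) planar)))
  where
  walk : ∀ {G K} → Star (Step ops) G K → Drawing (proj₂ G) → Drawing (proj₂ K)
  walk ε            = id
  walk (s ◅ steps)  = walk steps ∘ drawing-step s

-- The complete graph on five vertices is not planar

module K₅ (G : GraphOn 5) (complete : ∀ {u v} → u ≢ v → Adj G u v)
          (planar : Planar (5 , G)) where

  open RotationSystem (proj₁ planar) renaming (cycles to orbits)
  open Spherical (proj₂ planar) renaming (components to pieces)
  open Numbered G

  dartTo : ∀ u → Fin 4 → Dart G
  dartTo u w = dart u (punchIn u w) (complete (punchInᵢ≢i u w ∘ sym))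

  V≡5 : V ≡ 5
  V≡5 = classes-unique vertices (tail , (λ u → dartTo u zero , refl) , orbits)

  E*2≡size : E * 2 ≡ size
  E*2≡size = begin
    E * 2                           ≡⟨ cong (_* 2) (classes-unique edges
      (edge-classes ι-injective ι-onto (ι-conjugate reverse))) ⟩
    cycles (conjugate reverse) * 2  ≡⟨ dart-count ι-injective ι-onto (ι-conjugate reverse) ⟩
    size                            ∎
    where open ≡-Reasoning

  20≤size : 20 ≤ size
  20≤size = injective⇒≤ {f = ι ∘ uncurry dartTo ∘ remQuot {5} 4} λ {i} {j} eq →
    trans (sym (combine-remQuot {5} 4 i))
      (trans (cong (uncurry combine) (dartTo-injective _ _ (ι-injective eq))) (combine-remQuot {5} 4 j))
    where
    dartTo-injective : ∀ p q → uncurry dartTo p ≡ uncurry dartTo q → p ≡ q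
    dartTo-injective (u , w) (u′ , w′) eq with refl ← cong tail eq =
      cong (u ,_) (punchIn-injective u w w′ (cong head eq))

  1≤C : 1 ≤ C
  1≤C with C | pieces
  ... | zero  | c , _ with () ← c (dartTo zero zero)
  ... | suc _ | _     = s≤s z≤n

  tail-next : ∀ d → tail (next d) ≡ tail d
  tail-next d = sym (from (orbits d (next d)) (1 , refl))

  tail-nextOnFace : ∀ d → tail (nextOnFace d) ≡ head d
  tail-nextOnFace d = tail-next (reverse d)

  nextOnFace-≢ : ∀ d → nextOnFace d ≢ d
  nextOnFace-≢ d eq = tail≢head d (trans (cong tail (sym eq)) (tail-nextOnFace d))

  iterate-fixed : ∀ {d} k → next d ≡ d → iterate next d k ≡ d
  iterate-fixed zero    eq = refl
  iterate-fixed (suc k) eq = trans (cong (λ e → iterate next e k) eq) (iterate-fixed k eq)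

  -- A dart fixed by `next` would be the only one at its tail, but four darts leave every vertex.
  next-≢ : ∀ d → next d ≢ d
  next-≢ d eq = 0≢1 (punchIn-injective (tail d) zero (suc zero)
      (trans (sym (unique-head zero)) (unique-head (suc zero))))
    where
    unique-head : ∀ w → head d ≡ punchIn (tail d) w
    unique-head w = let (k , reach) = to (orbits d (dartTo (tail d) w)) refl in
      cong head (trans (sym (iterate-fixed k eq)) reach)

    0≢1 : zero ≢ suc {3} zero
    0≢1 ()

  -- On a face with two sides, `reverse d` and `next (reverse d)` would have the same tail and the
  -- same head, hence be equal.
  nextOnFace²-≢ : ∀ d → nextOnFace (nextOnFace d) ≢ d
  nextOnFace²-≢ d eq = next-≢ (reverse d) (dart-≡ (tail-nextOnFace d)
    (trans (sym (tail-nextOnFace (nextOnFace d))) (cong tail eq)))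

  -- The first three darts of a face are distinct by the preceding inequalities, and different faces
  -- share no dart.
  F*3≤size : F * 3 ≤ size
  F*3≤size = injective⇒≤ {f = ι ∘ uncurry onFace ∘ remQuot {F} 3} λ {i} {j} eq →
    trans (sym (combine-remQuot {F} 3 i))
      (trans (cong (uncurry combine) (onFace-injective _ _ (ι-injective eq))) (combine-remQuot {F} 3 j))
    where
    face = proj₁ faces
    face-onto = proj₁ (proj₂ faces)
    face⇔ = proj₂ (proj₂ faces)

    onFace : Fin F → Fin 3 → Dart G
    onFace i j = iterate nextOnFace (proj₁ (face-onto i)) (toℕ j)

    face-onFace : ∀ i j → face (onFace i j) ≡ i
    face-onFace i j = trans (sym (from (face⇔ _ _) (toℕ j , refl))) (proj₂ (face-onto i))

    onFace-injective : ∀ p q → uncurry onFace p ≡ uncurry onFace q → p ≡ q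
    onFace-injective (i , j) (i′ , j′) eq
      with refl ← trans (sym (face-onFace i j)) (trans (cong face eq) (face-onFace i′ j′)) =
      cong (i ,_) (distinct j j′ eq)
      where
      d = proj₁ (face-onto i)
      distinct : ∀ j j′ → onFace i j ≡ onFace i j′ → j ≡ j′
      distinct zero             zero             _  = refl
      distinct (suc zero)       (suc zero)       _  = refl
      distinct (suc (suc zero)) (suc (suc zero)) _  = refl
      distinct zero             (suc zero)       eq = contradiction (sym eq) (nextOnFace-≢ d)
      distinct (suc zero)       zero             eq = contradiction eq (nextOnFace-≢ d)
      distinct zero             (suc (suc zero)) eq = contradiction (sym eq) (nextOnFace²-≢ d)
      distinct (suc (suc zero)) zero             eq = contradiction eq (nextOnFace²-≢ d)
      distinct (suc zero)       (suc (suc zero)) eq = contradiction (sym eq) (nextOnFace-≢ _)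
      distinct (suc (suc zero)) (suc zero)       eq = contradiction eq (nextOnFace-≢ _)

  -- Every face has at least three sides, so 3F ≤ 2E, and Euler's formula gives
  -- E ≤ 9.
  absurd : ⊥
  absurd = ℕ.<-irrefl refl (begin-strict
    E              ≤⟨ ℕ.+-cancelˡ-≤ (E * 2 + 6) E 9 (begin
      E * 2 + 6 + E          ≡⟨ shuffle E ⟩
      3 * (E + 2 * 1)        ≤⟨ ℕ.*-monoʳ-≤ 3 (ℕ.+-monoʳ-≤ E (ℕ.*-monoʳ-≤ 2 1≤C)) ⟩
      3 * (E + 2 * C)        ≡⟨ cong (3 *_) (trans (sym euler) (cong (_+ F) V≡5)) ⟩
      3 * (5 + F)            ≡⟨ shuffle′ F ⟩
      F * 3 + 15             ≤⟨ ℕ.+-monoˡ-≤ 15 (ℕ.≤-trans F*3≤size (ℕ.≤-reflexive (sym E*2≡size))) ⟩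
      E * 2 + 15             ≡⟨ ℕ.+-assoc (E * 2) 6 9 ⟨
      E * 2 + 6 + 9          ∎) ⟩
    9              <⟨ ℕ.≤-refl ⟩
    10             ≤⟨ ℕ.*-cancelʳ-≤ 10 E 2 (ℕ.≤-trans 20≤size (ℕ.≤-reflexive (sym E*2≡size))) ⟩
    E              ∎)
    where
    open ℕ.≤-Reasoning
    shuffle : ∀ p → p * 2 + 6 + p ≡ 3 * (p + 2 * 1)
    shuffle = solve-∀
    shuffle′ : ∀ p → 3 * (5 + p) ≡ p * 3 + 15
    shuffle′ = solve-∀

-- Independent sets and cliques

module _ {p} {P : A → Set p} (P? : ∀ x → Dec (P x)) where

  length-split : ∀ xs → length xs ≡ length (filter P? xs) + length (filter (¬? ∘ P?) xs)
  length-split []       = refl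
  length-split (x ∷ xs) with P? x
  ... | yes _ = cong suc (length-split xs)
  ... | no _  = trans (cong suc (length-split xs)) (sym (ℕ.+-suc _ _))

lookup-AllPairs : {R : Rel A 0ℓ} → (∀ {x y} → R x y → R y x) → {xs : List A} →
                  AllPairs R xs → ∀ {i j} → i ≢ j → R (List.lookup xs i) (List.lookup xs j)
lookup-AllPairs R-sym (Rx ∷ Rxs) {zero}  {zero}  i≢j = contradiction refl i≢j
lookup-AllPairs R-sym (Rx ∷ Rxs) {zero}  {suc j} i≢j = All.lookup Rx (∈-lookup j)
lookup-AllPairs R-sym (Rx ∷ Rxs) {suc i} {zero}  i≢j = R-sym (All.lookup Rx (∈-lookup i))
lookup-AllPairs R-sym (Rx ∷ Rxs) {suc i} {suc j} i≢j =
  lookup-AllPairs R-sym Rxs (i≢j ∘ cong suc)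

module _ (G : GraphOn n) where

  NonAdj : Rel (Fin n) 0ℓ
  NonAdj u v = u ≢ v × ¬ Adj G u v

  adj? : ∀ u v → Dec (Adj G u v)
  adj? u v = T? (adj G u v)

  Sublist : Rel (Fin n) 0ℓ → ℕ → List (Fin n) → Set
  Sublist R k xs = ∃[ ys ] length ys ≡ k × AllPairs R ys × ys ⊆ xs

  -- The first vertex `x` extends a clique among its neighbours or an independent set among its
  -- non-neighbours. The bound halves when `k` or `l` drops by one, so one of the two sets is large
  -- enough.
  ramsey : ∀ k l xs → AllPairs _≢_ xs → 2 ^ (k + l) ≤ length xs →
           Sublist (Adj G) k xs ⊎ Sublist NonAdj l xs
  ramsey zero    l       xs       _  _ = inj₁ ([] , refl , [] , λ ())
  ramsey (suc k) zero    xs       _  _ = inj₂ ([] , refl , [] , λ ())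
  ramsey (suc k) (suc l) []       _  large =
    contradiction large (ℕ.<⇒≱ (ℕ.m^n>0 2 (suc k + suc l)))
  ramsey (suc k) (suc l) (x ∷ xs) (x≢xs ∷ unique) large
    with 2 ^ (k + suc l) ℕ.≤? length (filter (adj? x) xs)
  ... | yes large′ with ramsey k (suc l) _ (AllPairs.filter⁺ (adj? x) unique) large′
  ...   | inj₁ (ys , ≡k , clique , ys⊆) =
    inj₁ (x ∷ ys , cong suc ≡k ,
      All-resp-⊇ ys⊆ (all-filter (adj? x) xs) ∷ clique ,
      ∷⁺ʳ x (filter-⊆ (adj? x) xs ∘ ys⊆))
  ...   | inj₂ (ys , ≡l , indep , ys⊆) =
    inj₂ (ys , ≡l , indep , there ∘ filter-⊆ (adj? x) xs ∘ ys⊆)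
  ramsey (suc k) (suc l) (x ∷ xs) (x≢xs ∷ unique) large | no ¬large
    with ramsey (suc k) l _ (AllPairs.filter⁺ (¬? ∘ adj? x) unique) large′
    where
    N = length (filter (adj? x) xs)
    M = length (filter (¬? ∘ adj? x) xs)
    large′ : 2 ^ (suc k + l) ≤ M
    -- The vertex `x`, which lies in neither set, is made up for by the strictness of
    -- `N < 2 ^ (k + suc l)`.
    large′ = ℕ.+-cancelˡ-≤ (suc N) _ _ (begin
      suc N + 2 ^ (suc k + l)                ≤⟨ ℕ.+-monoˡ-≤ _ (ℕ.≰⇒> ¬large) ⟩
      2 ^ (k + suc l) + 2 ^ (suc k + l)      ≡⟨ cong (λ p → 2 ^ (k + suc l) + 2 ^ p) (ℕ.+-suc k l) ⟨
      2 ^ (k + suc l) + 2 ^ (k + suc l)      ≡⟨ cong (2 ^ (k + suc l) +_) (ℕ.+-identityʳ _) ⟨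
      2 ^ (suc k + suc l)                    ≤⟨ large ⟩
      suc (length xs)                        ≡⟨ cong suc (length-split (adj? x) xs) ⟩
      suc N + M                              ∎)
      where open ℕ.≤-Reasoning
  ... | inj₁ (ys , ≡k , clique , ys⊆) =
    inj₁ (ys , ≡k , clique , there ∘ filter-⊆ (¬? ∘ adj? x) xs ∘ ys⊆)
  ... | inj₂ (ys , ≡l , indep , ys⊆) =
    inj₂ (x ∷ ys , cong suc ≡l ,
      All.zip (All-resp-⊇ (filter-⊆ (¬? ∘ adj? x) xs ∘ ys⊆) x≢xs ,
               All-resp-⊇ ys⊆ (all-filter (¬? ∘ adj? x) xs)) ∷ indep ,
      ∷⁺ʳ x (filter-⊆ (¬? ∘ adj? x) xs ∘ ys⊆))

-- Enumerations, unlike subsets, pass through the operations by composition with `punchIn`;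
-- `independent-≤` returns to subsets.
IndependentPlacement : ∀ {n} → ℕ → GraphOn n → Set
IndependentPlacement {n} s G =
  Σ[ f ∈ (Fin s → Fin n) ] Inj f × (∀ i j → ¬ Adj G (f i) (f j))

independent? : ∀ s (G : GraphOn n) → Dec (IndependentPlacement s G)
independent? s G = anyFunction?
  (λ f → injective? f ×-dec all? (λ i → all? λ j → ¬? (T? (adj G (f i) (f j)))))
  (λ f≗g (inj , indep) →
    (λ {i} {j} eq → inj (trans (f≗g i) (trans eq (sym (f≗g j))))) ,
    (λ i j → subst₂ (λ u v → ¬ Adj G u v) (f≗g i) (f≗g j) (indep i j)))

clique-or-independent : ∀ k s (G : GraphOn n) → 2 ^ (k + s) ≤ n →
  (Σ[ f ∈ (Fin k → Fin n) ] ∀ {i j} → i ≢ j → Adj G (f i) (f j)) ⊎ IndependentPlacement s G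
clique-or-independent {n} k s G large
  with ramsey G k s (allFin n) (allFin⁺ n) (subst (2 ^ (k + s) ≤_) (sym (length-tabulate id)) large)
... | inj₁ (ys , refl , clique , _) =
  inj₁ (List.lookup ys , lookup-AllPairs (λ {u} {v} → subst T (symmetric G u v)) clique)
... | inj₂ (ys , refl , indep , _) =
  inj₂ (List.lookup ys ,
    (λ {i} {j} eq → decidable-stable (i ≟ j) λ i≢j → proj₁ (pairwise i≢j) eq) ,
    (λ i j → by-cases i j (i ≟ j)))
  where
  pairwise : ∀ {i j} → i ≢ j → NonAdj G (List.lookup ys i) (List.lookup ys j)
  pairwise = lookup-AllPairs
    (λ (u≢v , ¬p) → u≢v ∘ sym , ¬p ∘ subst T (symmetric G _ _)) indep

  by-cases : ∀ i j → Dec (i ≡ j) → ¬ Adj G (List.lookup ys i) (List.lookup ys j)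
  by-cases i j (yes refl) = subst T (irreflexive G _)
  by-cases i j (no i≢j)   = proj₂ (pairwise i≢j)

clique⇒nonplanar : (G : GraphOn n) (f : Fin 5 → Fin n) →
                   (∀ {i j} → i ≢ j → Adj G (f i) (f j)) → ¬ Planar (n , G)
clique⇒nonplanar G f clique planar =
  K₅.absurd K clique (drawing⇒planar K
    (drawing-pullback f f-injective (λ _ _ → refl) (planar⇒drawing G planar)))
  where
  K : GraphOn 5
  K = record
    { adj = λ i j → adj G (f i) (f j)
    ; symmetric = λ i j → symmetric G (f i) (f j)
    ; irreflexive = λ i → irreflexive G (f i) }

  f-injective : Inj f
  f-injective {i} {j} eq = decidable-stable (i ≟ j) λ i≢j →
    subst T (irreflexive G (f j)) (subst (λ u → Adj G u (f j)) eq (clique i≢j))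

-- Surviving vertices keep their adjacencies, contraction at most adding some, so survivors that are
-- nonadjacent afterwards were nonadjacent before.
independent-step : ∀ {s G H} → Step ops G H →
                   IndependentPlacement s (proj₂ H) → IndependentPlacement s (proj₂ G)
independent-step {s = s} step (f , f-inj , indep) = go step f f-inj indep
  where
  contracted : ∀ {n} (G : GraphOn (suc n)) u v (f : Fin s → Fin n) → Inj f →
    (∀ i j → ¬ Adj (contract G u v) (f i) (f j)) → IndependentPlacement s G
  contracted G u v f f-inj indep = punchIn v ∘ f ,
    f-inj ∘ punchIn-injective v _ _ ,
    λ i j p → indep i j (from (contract-adj G u v (f i) (f j))
      ((λ eq → subst T (irreflexive G _) (subst (λ w → Adj G (punchIn v w) (punchIn v (f j))) eq p)) ,
       inj₁ p))

  go : ∀ {G H} → Step _ G H → (f : Fin s → Fin (proj₁ H)) → Inj f →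
       (∀ i j → ¬ Adj (proj₂ H) (f i) (f j)) → IndependentPlacement s (proj₂ G)
  go (vertexDeletion _ G v) f f-inj indep =
    punchIn v ∘ f , f-inj ∘ punchIn-injective v _ _ , indep
  go (edgeContraction _ G u v _)       = contracted G u v
  go (vertexDissolution _ G u v _ _ _) = contracted G u v

independent-contains : ∀ {s G H} → Contains ops G H →
                       IndependentPlacement s (proj₂ H) → IndependentPlacement s (proj₂ G)
independent-contains {ops} {s} {H = H} (K , steps , (φ , φ-adj)) (f , f-inj , indep) =
  walk steps (Inverse.from φ ∘ f ,
    (λ eq → f-inj (trans (sym (Inverse.strictlyInverseˡ φ _))
      (trans (cong (Inverse.to φ) eq) (Inverse.strictlyInverseˡ φ _)))) ,
    (λ i j p → indep i j (subst₂ (Adj (proj₂ H)) (Inverse.strictlyInverseˡ φ _) (Inverse.strictlyInverseˡ φ _)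
      (subst T (φ-adj _ _) p))))
  where
  walk : ∀ {G K} → Star (Step ops) G K →
         IndependentPlacement s (proj₂ K) → IndependentPlacement s (proj₂ G)
  walk ε           = id
  walk (s ◅ steps) = independent-step s ∘ walk steps

rank : (S : Subset n) → ∀ {x} → x ∈ S → Fin ∣ S ∣
rank (true  ∷ S) here      = zero
rank (true  ∷ S) (there p) = suc (rank S p)
rank (false ∷ S) (there p) = rank S p

rank-injective : (S : Subset n) → ∀ {x y} (p : x ∈ S) (q : y ∈ S) → rank S p ≡ rank S q → x ≡ y
rank-injective (true  ∷ S) here      here      _  = refl
rank-injective (true  ∷ S) (there p) (there q) eq = cong suc (rank-injective S p q (suc-injective eq))
rank-injective (false ∷ S) (there p) (there q) eq = cong suc (rank-injective S p q eq)

independent-≤ : ∀ {s k G} → IndependentPlacement s (proj₂ G) → IndependenceNumber G k → s ≤ k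
independent-≤ {s} {k} {n , G} (f , f-inj , indep) (_ , bound) =
  ℕ.≤-trans (injective⇒≤ {f = λ i → rank image (f∈ i)} (f-inj ∘ rank-injective image _ _))
    (bound image λ u v u∈ v∈ → let (i , fi≡u) = ∈⇒ u∈ ; (j , fj≡v) = ∈⇒ v∈ in
      subst₂ (λ u v → ¬ Adj G u v) fi≡u fj≡v (indep i j))
  where
  image? : ∀ v → Dec (∃[ i ] f i ≡ v)
  image? v = any? (λ i → f i ≟ v)

  image : Subset n
  image = tabulate (does ∘ image?)

  f∈ : ∀ i → f i ∈ image
  f∈ i = lookup⇒[]= (f i) image
    (trans (lookup∘tabulate (does ∘ image?) (f i)) (dec-true (image? (f i)) (i , refl)))

  ∈⇒ : ∀ {v} → v ∈ image → ∃[ i ] f i ≡ v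
  ∈⇒ {v} v∈ with image? v | trans (sym (lookup∘tabulate (does ∘ image?) v)) ([]=⇒lookup v∈)
  ... | yes found | _ = found

-- The finitely many open cases

-- Every Boolean matrix becomes a graph in this way, so graphs are enumerated by enumerating
-- matrices; an adjacency matrix gives back its own graph.
symmetrize : (Fin n → Fin n → Bool) → GraphOn n
symmetrize M = record
  { adj         = λ u v → not (does (u ≟ v)) ∧ (M u v ∨ M v u)
  ; symmetric   = λ u v → cong₂ (λ b c → not b ∧ c)
      (does-⇔ (mk⇔ sym sym) (u ≟ v) (v ≟ u)) (∨-comm (M u v) (M v u))
  ; irreflexive = λ v → cong (λ b → not b ∧ (M v v ∨ M v v)) (dec-true (v ≟ v) refl)
  }

symmetrize-adj : (G : GraphOn n) {M : Fin n → Fin n → Bool} → (∀ u v → M u v ≡ adj G u v) →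
                 ∀ u v → adj G u v ≡ adj (symmetrize M) u v
symmetrize-adj G {M} M≗ u v with u ≟ v
... | yes refl = irreflexive G u
... | no _     = begin
  adj G u v              ≡⟨ ∨-idem (adj G u v) ⟨
  adj G u v ∨ adj G u v  ≡⟨ cong (adj G u v ∨_) (symmetric G u v) ⟩
  adj G u v ∨ adj G v u  ≡⟨ cong₂ _∨_ (M≗ u v) (M≗ v u) ⟨
  M u v ∨ M v u          ∎
  where open ≡-Reasoning

fromMatrix : Vec (Vec Bool n) n → Graph
fromMatrix {n} M = n , symmetrize (λ u v → lookup (lookup M u) v)

graphsOn : ℕ → List Graph
graphsOn n = map fromMatrix (allVecs (allVecs (true ∷ false ∷ []) n) n)

graphsUpTo : ℕ → List Graph
graphsUpTo zero    = graphsOn zero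
graphsUpTo (suc n) = graphsOn (suc n) ++ graphsUpTo n

graphsOn⊆ : ∀ {n N} → n ≤ N → graphsOn n ⊆ graphsUpTo N
graphsOn⊆ {N = zero}  z≤n = id
graphsOn⊆ {n} {suc N} n≤N with ℕ.m≤n⇒m<n∨m≡n n≤N
... | inj₁ (s≤s n≤N′) = ∈-++⁺ʳ (graphsOn (suc N)) ∘ graphsOn⊆ n≤N′
... | inj₂ refl       = ∈-++⁺ˡ

matrix : GraphOn n → Vec (Vec Bool n) n
matrix G = tabulate (λ u → tabulate (adj G u))

-- Adjacency functions are compared only pointwise, so what is found in the list is this isomorphic
-- graph rather than `G`.
copy : GraphOn n → Graph
copy G = fromMatrix (matrix G)

≅-copy : (G : GraphOn n) → (n , G) ≅ copy G
≅-copy G = ↔-id _ , symmetrize-adj G λ u v →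
  trans (cong (λ row → lookup row v) (lookup∘tabulate (λ u → tabulate (adj G u)) u))
        (lookup∘tabulate (adj G u) v)

copy∈ : ∀ {N} (G : GraphOn n) → n ≤ N → copy G ∈ˡ graphsUpTo N
copy∈ G n≤N = graphsOn⊆ n≤N (∈-map⁺ fromMatrix {x = matrix G}
  (∈-allVecs (∈-allVecs λ { true → here refl ; false → there (here refl) }) (matrix G)))

≅-independent : ∀ {s G H} → G ≅ H →
                IndependentPlacement s (proj₂ H) → IndependentPlacement s (proj₂ G)
≅-independent {G = G} {H} G≅H = independent-contains {ops = []} {H = H} (G , ε , G≅H)

module OpenCases (s N : ℕ) (large : 2 ^ (5 + s) ≤ N) where

  Open : Graph → Set
  Open H = Planar H × ¬ IndependentPlacement s (proj₂ H)

  open? : ∀ H → Dec (Open H)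
  open? H = planar? H ×-dec ¬? (independent? s (proj₂ H))

  openCases : List Graph
  openCases = filter open? (graphsUpTo N)

  openCases-sound : All (λ H → Planar H × (s P₁ -free) H) openCases
  openCases-sound = All.map
    (λ (planar , dependent) → planar , λ contains →
      dependent (independent-contains {H = s P₁} contains (id , id , λ _ _ ())))
    (all-filter open? (graphsUpTo N))

  openCases-complete : ∀ H → ¬ Any (H ≅_) openCases →
                       IndependentPlacement s (proj₂ H) ⊎ ¬ Planar H
  openCases-complete H@(n , G) H∉ =
    by-cases (independent? s G) (Sum.map₂ (clique-or-independent 5 s G ∘ ℕ.≤-trans large) (ℕ.≤-total n N))
    where
    by-cases : Dec (IndependentPlacement s G) →
               n ≤ N ⊎ (Σ[ f ∈ (Fin 5 → Fin n) ] ∀ {i j} → i ≢ j → Adj G (f i) (f j)) ⊎ IndependentPlacement s G →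
               IndependentPlacement s G ⊎ ¬ Planar H
    by-cases (yes indep) _                            = inj₁ indep
    by-cases (no _)      (inj₂ (inj₂ indep))          = inj₁ indep
    by-cases (no _)      (inj₂ (inj₁ (f , clique)))   = inj₂ (clique⇒nonplanar G f clique)
    by-cases (no dependent) (inj₁ small) = inj₂ λ planar → H∉ (lose
      (∈-filter⁺ open? {x = copy G} (copy∈ G small)
        (planar-≅ {H = copy G} (≅-copy G) planar ,
         dependent ∘ ≅-independent {G = H} {H = copy G} (≅-copy G)))
      (≅-copy G))

-- A reduction into `𝒞` also lands in the larger class `𝒟`, and membership in NP does not mention
-- the class.
NPComplete-mono : ∀ {Π} {𝒞 𝒟 : GraphClass} → (∀ G → 𝒞 G → 𝒟 G) →
                  NPComplete Π 𝒞 → NPComplete Π 𝒟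
NPComplete-mono 𝒞⊆𝒟 (inNP , hard) = inNP , λ L L∈NP →
  let (f , f-poly , reduction) = hard L L∈NP in
  f , f-poly , λ w →
    let ((G , y , 𝒞G , eq) , correct) = reduction w in (G , y , 𝒞⊆𝒟 G 𝒞G , eq) , correct

theorem2 : (Π : GraphProblem) → C46-Problem Π →
    Σ[ openCases ∈ List Graph ]
    ((H : Graph) → ¬ Any (H ≅_) openCases →
    NPComplete Π (H -free) ×
    NPComplete Π (H -contraction-free) ×
    NPComplete Π (H -induced-minor-free) ×
    NPComplete Π (H -induced-topological-minor-free)) ×
    (Σ[ s ∈ ℕ ] s ≥ 1 × All (λ H → Planar H × (s P₁ -free) H) openCases)
theorem2 Π (c4 , (𝒞 , (c , bounded) , c6)) =
  openCases ,
  (λ H H∉ → let hard = NPComplete-free H (openCases-complete H H∉) in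
    hard _ , hard _ , hard _ , hard _) ,
  suc c , s≤s z≤n , openCases-sound
  where
  open OpenCases (suc c) (2 ^ (5 + suc c)) ℕ.≤-refl

  NPComplete-free : ∀ H → IndependentPlacement (suc c) (proj₂ H) ⊎ ¬ Planar H →
                    ∀ ops → NPComplete Π (λ G → ¬ Contains ops G H)
  NPComplete-free H (inj₁ indep) ops = NPComplete-mono {𝒟 = λ G → ¬ Contains ops G H}
    (λ G 𝒞G contains → let (k , number , k≤c) = bounded G 𝒞G in
      ℕ.<-irrefl refl (ℕ.≤-trans (independent-≤ {G = G} (independent-contains {H = H} contains indep) number) k≤c))
    c6
  NPComplete-free H (inj₂ nonplanar) ops = NPComplete-mono {𝒟 = λ G → ¬ Contains ops G H}
    (λ G planar contains → nonplanar (planar-contains {H = H} contains planar)) c4
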